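{- Let $G^\sigma$ be an oriented graph whose underlying graph $G$ is a simple connected graph with $n$ vertices and $m$ edges. Then $$\frac{sr(G^\sigma)}{\alpha(G)}\geqslant \frac{4(2n-m-1)}{\sqrt{4n(n-1)-8m+1}+1}-2,$$ with equality if and only if $G\cong S_n$ or $G\cong C_3$.
   Context: An oriented graph $G^\sigma$ is obtained from a simple graph $G$ by assigning a direction to each edge. Its skew-adjacency matrix $S(G^\sigma)=[s_{x,y}]$ has $s_{x,y}=1$ if there is an arc from $x$ to $y$, $s_{x,y}=-1$ if there is an arc from $y$ to $x$, and $0$ otherwise; the skew-rank $sr(G^\sigma)$ is the rank of $S(G^\sigma)$. $\alpha(G)$ is the independence number of $G$. $S_n$ denotes the star on $n$ vertices (the single vertex when $n=1$) and $C_3$ the triangle. -}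

module Defs where

open import Level using (0ℓ)
open import Data.Bool.Base using (if_then_else_)
open import Data.Nat.Base as ℕ using (ℕ; zero; suc)
import Data.Nat.Properties as ℕ
open import Data.Integer.Base as ℤ using (ℤ; +_; +[1+_]; -[1+_])
import Data.Integer.Properties as ℤ
open import Data.Rational.Base as ℚ using (ℚ; mkℚ; 0ℚ; 1ℚ; ½; ∣_∣)
import Data.Rational.Properties as ℚ
import Data.Rational.Unnormalised.Base as ℚᵘ
import Data.Rational.Unnormalised.Properties as ℚᵘ
open import Data.Rational.Solver using (module +-*-Solver)
open import Algebra.Properties.Monoid.Sum ℚ.+-0-monoid using (sum)
open import Data.Fin.Base as Fin using (Fin; toℕ)
import Data.Fin.Properties as Fin
open import Data.Fin.Subset using (Subset; _∈_; ⁅_⁆) renaming (∣_∣ to card)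
open import Data.Fin.Subset.Properties using (∣⁅x⁆∣≡1; x∈⁅y⁆⇒x≡y)
open import Data.List.Base using (length; filter; cartesianProduct; allFin)
open import Data.Product.Base using (∃-syntax; _×_; _,_)
open import Data.Sum.Base using (_⊎_; inj₁; inj₂; swap)
open import Function.Base using (_∘_)
open import Function.Bundles using (_↔_; _⇔_; module Inverse)
open import Relation.Binary.Core using (Rel)
open import Relation.Binary.Definitions using (Decidable; Symmetric; Irreflexive; Asymmetric)
open import Relation.Binary.Construct.Closure.ReflexiveTransitive using (Star)
open import Relation.Binary.PropositionalEquality
open import Relation.Nullary using (¬_; Dec; yes; no; does; contradiction)
open import Relation.Nullary.Decidable using (_×-dec_; _⊎-dec_; ¬?)

record Graph (n : ℕ) : Set₁ where
  field
    Adj        : Rel (Fin n) 0ℓ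
    adj?       : Decidable Adj
    adj-sym    : Symmetric Adj
    adj-irrefl : Irreflexive _≡_ Adj

open Graph public using (Adj; adj?)

numEdges : ∀ {n} → Graph n → ℕ
numEdges {n} G =
  length (filter (λ (x , y) → (x Fin.<? y) ×-dec adj? G x y)
                 (cartesianProduct (allFin n) (allFin n)))

-- The graph without vertices does not count as connected.
Connected : ∀ {n} → Graph n → Set
Connected {n} G = ℕ.NonZero n × (∀ x y → Star (Adj G) x y)

infix 4 _≅_
record _≅_ {n k} (G : Graph n) (H : Graph k) : Set where
  field
    bij      : Fin n ↔ Fin k
    preserve : ∀ x y → Adj G x y ⇔ Adj H (Inverse.to bij x) (Inverse.to bij y)

star : ∀ n → Graph n
star n = record
  { Adj        = λ x y → x ≢ y × (toℕ x ≡ 0 ⊎ toℕ y ≡ 0)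
  ; adj?       = λ x y → ¬? (x Fin.≟ y) ×-dec ((toℕ x ℕ.≟ 0) ⊎-dec (toℕ y ℕ.≟ 0))
  ; adj-sym    = λ (x≢y , c) → x≢y ∘ sym , swap c
  ; adj-irrefl = λ x≡y (x≢y , _) → x≢y x≡y
  }

triangle : Graph 3
triangle = record
  { Adj        = _≢_
  ; adj?       = λ x y → ¬? (x Fin.≟ y)
  ; adj-sym    = λ x≢y → x≢y ∘ sym
  ; adj-irrefl = λ x≡y x≢y → x≢y x≡y
  }

Independent : ∀ {n} → Graph n → Subset n → Set
Independent G I = ∀ {x y} → x ∈ I → y ∈ I → ¬ Adj G x y

IsIndependenceNumber : ∀ {n} → Graph n → ℕ → Set
IsIndependenceNumber G a =
  (∃[ I ] Independent G I × card I ≡ a) × (∀ I → Independent G I → card I ℕ.≤ a)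

record Orientation {n} (G : Graph n) : Set₁ where
  field
    Arc     : Rel (Fin n) 0ℓ
    arc⇒adj : ∀ {x y} → Arc x y → Adj G x y
    adj⇒arc : ∀ {x y} → Adj G x y → Arc x y ⊎ Arc y x
    asym    : Asymmetric Arc

  arc? : Decidable Arc
  arc? x y with adj? G x y
  ... | no ¬adj = no (¬adj ∘ arc⇒adj)
  ... | yes adj with adj⇒arc adj
  ...   | inj₁ x→y = yes x→y
  ...   | inj₂ y→x = no (asym y→x)

-- Ranks are taken over ℚ: a matrix with rational entries has the same rank over ℝ.
Matrix : ℕ → ℕ → Set
Matrix m n = Fin m → Fin n → ℚ

LinearlyIndependent : ∀ {k m} → (Fin k → Fin m → ℚ) → Set
LinearlyIndependent {k} v =
  ∀ (c : Fin k → ℚ) → (∀ x → sum (λ i → c i ℚ.* v i x) ≡ 0ℚ) → ∀ i → c i ≡ 0ℚ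

-- A family of columns with a repetition is never linearly independent, so the
-- index functions below need not be required to be injective.
IsRank : ∀ {m n} → Matrix m n → ℕ → Set
IsRank {m} {n} M r = (∃[ f ] IndependentColumns {r} f)
                   × (∀ k (f : Fin k → Fin n) → IndependentColumns f → k ℕ.≤ r)
  where
  IndependentColumns : ∀ {k} → (Fin k → Fin n) → Set
  IndependentColumns f = LinearlyIndependent (λ i x → M x (f i))

skewAdjacency : ∀ {n} {G : Graph n} → Orientation G → Matrix n n
skewAdjacency σ x y =
  if does (arc? x y) then 1ℚ else
  if does (arc? y x) then ℚ.- 1ℚ else 0ℚ
  where open Orientation σ

IsSkewRank : ∀ {n} {G : Graph n} → Orientation G → ℕ → Set
IsSkewRank σ = IsRank (skewAdjacency σ)

independenceNumber-nonZero : ∀ {n} (G : Graph n) {a} →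
  Connected G → IsIndependenceNumber G a → ℕ.NonZero a
independenceNumber-nonZero {suc n} G {a} _ (_ , max) =
  ℕ.>-nonZero (subst (ℕ._≤ a) (∣⁅x⁆∣≡1 v) (max ⁅ v ⁆ ind))
  where
  v : Fin (suc n)
  v = Fin.zero
  ind : Independent G ⁅ v ⁆
  ind x∈ y∈ = Graph.adj-irrefl G (trans (x∈⁅y⁆⇒x≡y v x∈) (sym (x∈⁅y⁆⇒x≡y v y∈)))

infix 9 _²
_² : ℚ → ℚ
q ² = q ℚ.* q

half-pos : ∀ {ε} → 0ℚ ℚ.< ε → 0ℚ ℚ.< ½ ℚ.* ε
half-pos {ε} 0<ε = subst (ℚ._< ½ ℚ.* ε) (ℚ.*-zeroʳ ½) (ℚ.*-monoʳ-<-pos ½ 0<ε)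

half+half : ∀ ε → ½ ℚ.* ε ℚ.+ ½ ℚ.* ε ≡ ε
half+half ε = trans (sym (ℚ.*-distribʳ-+ ε ½ ½)) (ℚ.*-identityˡ ε)

*-pos : ∀ {p q} → 0ℚ ℚ.< p → 0ℚ ℚ.< q → 0ℚ ℚ.< p ℚ.* q
*-pos {p} {q} 0<p 0<q =
  subst (ℚ._< p ℚ.* q) (ℚ.*-zeroʳ p) (ℚ.*-monoʳ-<-pos p {{ℚ.positive 0<p}} 0<q)

*-square-< : ∀ {p q} → 0ℚ ℚ.≤ q → p ² ℚ.< q ² → p ℚ.< q
*-square-< {p} {q} 0≤q p²<q² with p ℚ.<? q
... | yes p<q = p<q
... | no p≮q = contradiction (ℚ.<-≤-trans p²<q² (ℚ.≤-trans
        (ℚ.*-monoˡ-≤-nonNeg q {{ℚ.nonNegative 0≤q}} q≤p)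
        (ℚ.*-monoʳ-≤-nonNeg p {{ℚ.nonNegative (ℚ.≤-trans 0≤q q≤p)}} q≤p)))
        (ℚ.<-irrefl refl)
  where q≤p = ℚ.≮⇒≥ p≮q

p≤∣p∣ : ∀ p → p ℚ.≤ ∣ p ∣
p≤∣p∣ p with ℚ.≤-total 0ℚ p
... | inj₁ 0≤p = ℚ.≤-reflexive (sym (ℚ.0≤p⇒∣p∣≡p 0≤p))
... | inj₂ p≤0 = ℚ.≤-trans p≤0 (ℚ.0≤∣p∣ p)

p<q+ε : ∀ p q {ε} → ∣ p ℚ.- q ∣ ℚ.< ε → p ℚ.< q ℚ.+ ε
p<q+ε p q {ε} h = subst (ℚ._< q ℚ.+ ε) (eq p q)
                    (ℚ.+-monoʳ-< q (ℚ.≤-<-trans (p≤∣p∣ (p ℚ.- q)) h))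
  where
  open +-*-Solver
  eq : ∀ p q → q ℚ.+ (p ℚ.- q) ≡ p
  eq = solve 2 (λ p q → q :+ (p :- q) := p) refl

∣p-q∣<ε : ∀ {p q ε} → p ℚ.< q ℚ.+ ε → q ℚ.< p ℚ.+ ε → ∣ p ℚ.- q ∣ ℚ.< ε
∣p-q∣<ε {p} {q} {ε} p<q+ε q<p+ε with ℚ.∣p∣≡p∨∣p∣≡-p (p ℚ.- q)
... | inj₁ e = subst₂ ℚ._<_ (sym e) (eq q ε) (ℚ.+-monoˡ-< (ℚ.- q) p<q+ε)
  where
  open +-*-Solver
  eq : ∀ q ε → (q ℚ.+ ε) ℚ.- q ≡ ε
  eq = solve 2 (λ q ε → (q :+ ε) :- q := ε) refl
... | inj₂ e = subst₂ ℚ._<_ (trans (eq₁ p q) (sym e)) (eq₂ p ε) (ℚ.+-monoˡ-< (ℚ.- p) q<p+ε)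
  where
  open +-*-Solver
  eq₁ : ∀ p q → q ℚ.- p ≡ ℚ.- (p ℚ.- q)
  eq₁ = solve 2 (λ p q → q :- p := :- (p :- q)) refl
  eq₂ : ∀ p ε → (p ℚ.+ ε) ℚ.- p ≡ ε
  eq₂ = solve 2 (λ p ε → (p :+ ε) :- p := ε) refl

∣*∣-< : ∀ {p q B η} → 0ℚ ℚ.< B → ∣ p ∣ ℚ.≤ B → ∣ q ∣ ℚ.< η → ∣ p ℚ.* q ∣ ℚ.< B ℚ.* η
∣*∣-< {p} {q} {B} {η} 0<B p≤B q<η = begin-strict
  ∣ p ℚ.* q ∣      ≡⟨ ℚ.∣p*q∣≡∣p∣*∣q∣ p q ⟩
  ∣ p ∣ ℚ.* ∣ q ∣  ≤⟨ ℚ.*-monoʳ-≤-nonNeg ∣ q ∣ {{ℚ.∣-∣-nonNeg q}} p≤B ⟩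
  B ℚ.* ∣ q ∣      <⟨ ℚ.*-monoʳ-<-pos B {{ℚ.positive 0<B}} q<η ⟩
  B ℚ.* η          ∎
  where open ℚ.≤-Reasoning

divide : ∀ {B ε} → 0ℚ ℚ.< B → 0ℚ ℚ.< ε → ∃[ η ] 0ℚ ℚ.< η × B ℚ.* η ≡ ε
divide {B} {ε} 0<B 0<ε = 1/B ℚ.* ε , *-pos 0<1/B 0<ε ,
  trans (sym (ℚ.*-assoc B 1/B ε))
        (trans (cong (ℚ._* ε) (ℚ.*-inverseʳ B {{ℚ.>-nonZero 0<B}})) (ℚ.*-identityˡ ε))
  where
  1/B : ℚ
  1/B = (ℚ.1/ B) {{ℚ.>-nonZero 0<B}}
  0<1/B : 0ℚ ℚ.< 1/B
  0<1/B = ℚ.positive⁻¹ 1/B {{ℚ.1/pos⇒pos B {{ℚ.positive 0<B}}}}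

-- Cauchy sequences of rationals; equality of reals is _≃_.
record ℝ : Set where
  constructor mkℝ
  field
    seq    : ℕ → ℚ
    cauchy : ∀ ε → 0ℚ ℚ.< ε → ∃[ N ] (∀ i j → N ℕ.≤ i → N ℕ.≤ j → ∣ seq i ℚ.- seq j ∣ ℚ.< ε)

open ℝ public

infix 4 _≃_ _≤_ _≥_

_≃_ : ℝ → ℝ → Set
x ≃ y = ∀ ε → 0ℚ ℚ.< ε → ∃[ N ] (∀ k → N ℕ.≤ k → ∣ seq x k ℚ.- seq y k ∣ ℚ.< ε)

_≤_ : ℝ → ℝ → Set
x ≤ y = ∀ ε → 0ℚ ℚ.< ε → ∃[ N ] (∀ k → N ℕ.≤ k → seq x k ℚ.< seq y k ℚ.+ ε)

_≥_ : ℝ → ℝ → Set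
x ≥ y = y ≤ x

Positive : ℝ → Set
Positive x = ∃[ δ ] 0ℚ ℚ.< δ × ∃[ N ] (∀ k → N ℕ.≤ k → δ ℚ.≤ seq x k)

fromℚ : ℚ → ℝ
fromℚ q = mkℝ (λ _ → q)
  (λ ε 0<ε → 0 , λ _ _ _ _ → subst (ℚ._< ε) (sym (cong ∣_∣ (ℚ.+-inverseʳ q))) 0<ε)

fromℤ : ℤ → ℝ
fromℤ z = fromℚ (z ℚ./ 1)

infixl 6 _+_ _-_
infixl 7 _*_
infix  8 -_

_+_ : ℝ → ℝ → ℝ
x + y = mkℝ (λ k → seq x k ℚ.+ seq y k) cau
  where
  open +-*-Solver
  eq : ∀ a b c d → (a ℚ.+ b) ℚ.- (c ℚ.+ d) ≡ (a ℚ.- c) ℚ.+ (b ℚ.- d)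
  eq = solve 4 (λ a b c d → (a :+ b) :- (c :+ d) := (a :- c) :+ (b :- d)) refl
  cau : ∀ ε → 0ℚ ℚ.< ε → ∃[ N ] (∀ i j → N ℕ.≤ i → N ℕ.≤ j →
          ∣ (seq x i ℚ.+ seq y i) ℚ.- (seq x j ℚ.+ seq y j) ∣ ℚ.< ε)
  cau ε 0<ε with cauchy x (½ ℚ.* ε) (half-pos 0<ε) | cauchy y (½ ℚ.* ε) (half-pos 0<ε)
  ... | M , hx | N , hy = M ℕ.⊔ N , λ i j M⊔N≤i M⊔N≤j →
    subst₂ ℚ._<_ (cong ∣_∣ (sym (eq (seq x i) (seq y i) (seq x j) (seq y j)))) (half+half ε)
      (ℚ.≤-<-trans (ℚ.∣p+q∣≤∣p∣+∣q∣ (seq x i ℚ.- seq x j) (seq y i ℚ.- seq y j))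
        (ℚ.+-mono-< (hx i j (ℕ.m⊔n≤o⇒m≤o M N M⊔N≤i) (ℕ.m⊔n≤o⇒m≤o M N M⊔N≤j))
                    (hy i j (ℕ.m⊔n≤o⇒n≤o M N M⊔N≤i) (ℕ.m⊔n≤o⇒n≤o M N M⊔N≤j))))

-_ : ℝ → ℝ
- x = mkℝ (λ k → ℚ.- seq x k) cau
  where
  open +-*-Solver
  eq : ∀ a b → b ℚ.- a ≡ (ℚ.- a) ℚ.- (ℚ.- b)
  eq = solve 2 (λ a b → b :- a := (:- a) :- (:- b)) refl
  cau : ∀ ε → 0ℚ ℚ.< ε → ∃[ N ] (∀ i j → N ℕ.≤ i → N ℕ.≤ j →
          ∣ (ℚ.- seq x i) ℚ.- (ℚ.- seq x j) ∣ ℚ.< ε)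
  cau ε 0<ε with cauchy x ε 0<ε
  ... | N , hx = N , λ i j N≤i N≤j →
    subst (λ q → ∣ q ∣ ℚ.< ε) (eq (seq x i) (seq x j)) (hx j i N≤j N≤i)

_-_ : ℝ → ℝ → ℝ
x - y = x + (- y)

bounded : ∀ x → ∃[ B ] 0ℚ ℚ.< B × ∃[ N ] (∀ k → N ℕ.≤ k → ∣ seq x k ∣ ℚ.≤ B)
bounded x with cauchy x 1ℚ (ℚ.positive⁻¹ 1ℚ)
... | N , hx = 1ℚ ℚ.+ ∣ seq x N ∣ ,
      ℚ.<-≤-trans (ℚ.positive⁻¹ 1ℚ)
        (subst (ℚ._≤ 1ℚ ℚ.+ ∣ seq x N ∣) (ℚ.+-identityʳ 1ℚ) (ℚ.+-monoʳ-≤ 1ℚ (ℚ.0≤∣p∣ (seq x N)))) ,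
      N , λ k N≤k → begin
        ∣ seq x k ∣                                ≡⟨ cong ∣_∣ (eq (seq x k) (seq x N)) ⟨
        ∣ (seq x k ℚ.- seq x N) ℚ.+ seq x N ∣      ≤⟨ ℚ.∣p+q∣≤∣p∣+∣q∣ (seq x k ℚ.- seq x N) (seq x N) ⟩
        ∣ seq x k ℚ.- seq x N ∣ ℚ.+ ∣ seq x N ∣    ≤⟨ ℚ.+-monoˡ-≤ ∣ seq x N ∣ (ℚ.<⇒≤ (hx k N N≤k ℕ.≤-refl)) ⟩
        1ℚ ℚ.+ ∣ seq x N ∣                         ∎
  where
  open ℚ.≤-Reasoning
  open +-*-Solver
  eq : ∀ a b → (a ℚ.- b) ℚ.+ b ≡ a
  eq = solve 2 (λ a b → (a :- b) :+ b := a) refl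

_*_ : ℝ → ℝ → ℝ
x * y = mkℝ (λ k → seq x k ℚ.* seq y k) cau
  where
  open +-*-Solver
  eq : ∀ a b c d → (a ℚ.* b) ℚ.- (c ℚ.* d) ≡ a ℚ.* (b ℚ.- d) ℚ.+ d ℚ.* (a ℚ.- c)
  eq = solve 4 (λ a b c d → (a :* b) :- (c :* d) := a :* (b :- d) :+ d :* (a :- c)) refl
  cau : ∀ ε → 0ℚ ℚ.< ε → ∃[ N ] (∀ i j → N ℕ.≤ i → N ℕ.≤ j →
          ∣ (seq x i ℚ.* seq y i) ℚ.- (seq x j ℚ.* seq y j) ∣ ℚ.< ε)
  cau ε 0<ε =
    let B , 0<B , K , hB = bounded x
        C , 0<C , L , hC = bounded y
        η , 0<η , Bη = divide 0<B (half-pos 0<ε)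
        θ , 0<θ , Cθ = divide 0<C (half-pos 0<ε)
        M , hy = cauchy y η 0<η
        N , hx = cauchy x θ 0<θ
    in (K ℕ.⊔ L) ℕ.⊔ (M ℕ.⊔ N) , λ i j p q →
    let K≤i = ℕ.m⊔n≤o⇒m≤o K L (ℕ.m⊔n≤o⇒m≤o (K ℕ.⊔ L) (M ℕ.⊔ N) p)
        L≤j = ℕ.m⊔n≤o⇒n≤o K L (ℕ.m⊔n≤o⇒m≤o (K ℕ.⊔ L) (M ℕ.⊔ N) q)
        M⊔N≤i = ℕ.m⊔n≤o⇒n≤o (K ℕ.⊔ L) (M ℕ.⊔ N) p
        M⊔N≤j = ℕ.m⊔n≤o⇒n≤o (K ℕ.⊔ L) (M ℕ.⊔ N) q
        a = seq x i; b = seq y i; c = seq x j; d = seq y j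
    in subst₂ ℚ._<_ (cong ∣_∣ (sym (eq a b c d))) (trans (cong₂ ℚ._+_ Bη Cθ) (half+half ε))
      (ℚ.≤-<-trans (ℚ.∣p+q∣≤∣p∣+∣q∣ (a ℚ.* (b ℚ.- d)) (d ℚ.* (a ℚ.- c)))
        (ℚ.+-mono-<
          (∣*∣-< {a} {b ℚ.- d} 0<B (hB i K≤i)
            (hy i j (ℕ.m⊔n≤o⇒m≤o M N M⊔N≤i) (ℕ.m⊔n≤o⇒m≤o M N M⊔N≤j)))
          (∣*∣-< {d} {a ℚ.- c} 0<C (hC j L≤j)
            (hx i j (ℕ.m⊔n≤o⇒n≤o M N M⊔N≤i) (ℕ.m⊔n≤o⇒n≤o M N M⊔N≤j)))))

-- Only finitely many terms of a positive real are zero, so the value of recip at 0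
-- does not affect the reciprocal below.
recip : ℚ → ℚ
recip q with q ℚ.≟ 0ℚ
... | yes _  = 0ℚ
... | no q≢0 = (ℚ.1/ q) {{ℚ.≢-nonZero q≢0}}

recip-inverse : ∀ q → 0ℚ ℚ.< q → q ℚ.* recip q ≡ 1ℚ
recip-inverse q 0<q with q ℚ.≟ 0ℚ
... | yes q≡0 = contradiction (sym q≡0) (ℚ.<⇒≢ 0<q)
... | no q≢0  = ℚ.*-inverseʳ q {{ℚ.≢-nonZero q≢0}}

recip-pos : ∀ q → 0ℚ ℚ.< q → 0ℚ ℚ.< recip q
recip-pos q 0<q = ℚ.*-cancelˡ-<-nonNeg q {{ℚ.nonNegative (ℚ.<⇒≤ 0<q)}}
  (subst₂ ℚ._<_ (sym (ℚ.*-zeroʳ q)) (sym (recip-inverse q 0<q)) (ℚ.positive⁻¹ 1ℚ))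

recip-antimono : ∀ {p q} → 0ℚ ℚ.< p → p ℚ.≤ q → recip q ℚ.≤ recip p
recip-antimono {p} {q} 0<p p≤q = begin
  recip q                    ≡⟨ ℚ.*-identityˡ (recip q) ⟨
  1ℚ ℚ.* recip q             ≡⟨ cong (ℚ._* recip q) (recip-inverse p 0<p) ⟨
  p ℚ.* recip p ℚ.* recip q  ≤⟨ ℚ.*-monoʳ-≤-nonNeg (recip q) {{ℚ.nonNegative (ℚ.<⇒≤ (recip-pos q 0<q))}}
                                  (ℚ.*-monoʳ-≤-nonNeg (recip p) {{ℚ.nonNegative (ℚ.<⇒≤ (recip-pos p 0<p))}} p≤q) ⟩
  q ℚ.* recip p ℚ.* recip q  ≡⟨ eq q (recip p) (recip q) ⟩
  q ℚ.* recip q ℚ.* recip p  ≡⟨ cong (ℚ._* recip p) (recip-inverse q 0<q) ⟩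
  1ℚ ℚ.* recip p             ≡⟨ ℚ.*-identityˡ (recip p) ⟩
  recip p                    ∎
  where
  open ℚ.≤-Reasoning
  open +-*-Solver
  eq : ∀ a b c → a ℚ.* b ℚ.* c ≡ a ℚ.* c ℚ.* b
  eq = solve 3 (λ a b c → a :* b :* c := a :* c :* b) refl
  0<q = ℚ.<-≤-trans 0<p p≤q

reciprocal : (x : ℝ) → Positive x → ℝ
reciprocal x (δ , 0<δ , L , hδ) = mkℝ (λ k → recip (seq x k)) cau
  where
  open +-*-Solver
  eq : ∀ a b u v → a ℚ.* u ≡ 1ℚ → b ℚ.* v ≡ 1ℚ → u ℚ.- v ≡ u ℚ.* (v ℚ.* (b ℚ.- a))
  eq a b u v au bv = trans
    (sym (cong₂ ℚ._-_ (trans (cong (u ℚ.*_) bv) (ℚ.*-identityʳ u))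
                      (trans (cong (v ℚ.*_) au) (ℚ.*-identityʳ v))))
    (solve 4 (λ a b u v → u :* (b :* v) :- v :* (a :* u) := u :* (v :* (b :- a))) refl a b u v)
  bound : ∀ k → L ℕ.≤ k → ∣ recip (seq x k) ∣ ℚ.≤ recip δ
  bound k L≤k = subst (ℚ._≤ recip δ)
    (sym (ℚ.0≤p⇒∣p∣≡p (ℚ.<⇒≤ (recip-pos (seq x k) (ℚ.<-≤-trans 0<δ (hδ k L≤k))))))
    (recip-antimono 0<δ (hδ k L≤k))
  cau : ∀ ε → 0ℚ ℚ.< ε → ∃[ N ] (∀ i j → N ℕ.≤ i → N ℕ.≤ j →
          ∣ recip (seq x i) ℚ.- recip (seq x j) ∣ ℚ.< ε)
  cau ε 0<ε =
    let η , 0<η , Bη = divide (recip-pos δ 0<δ) 0<ε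
        θ , 0<θ , Bθ = divide (recip-pos δ 0<δ) 0<η
        N , hx = cauchy x θ 0<θ
    in L ℕ.⊔ N , λ i j L⊔N≤i L⊔N≤j →
    let L≤i = ℕ.m⊔n≤o⇒m≤o L N L⊔N≤i
        L≤j = ℕ.m⊔n≤o⇒m≤o L N L⊔N≤j
        a = seq x i; b = seq x j
    in subst₂ ℚ._<_
      (cong ∣_∣ (sym (eq a b (recip a) (recip b)
        (recip-inverse a (ℚ.<-≤-trans 0<δ (hδ i L≤i)))
        (recip-inverse b (ℚ.<-≤-trans 0<δ (hδ j L≤j))))))
      Bη
      (∣*∣-< {recip a} {recip b ℚ.* (b ℚ.- a)} (recip-pos δ 0<δ) (bound i L≤i)
        (subst (∣ recip b ℚ.* (b ℚ.- a) ∣ ℚ.<_) Bθ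
          (∣*∣-< {recip b} {b ℚ.- a} (recip-pos δ 0<δ) (bound j L≤j)
            (hx j i (ℕ.m⊔n≤o⇒n≤o L N L⊔N≤j) (ℕ.m⊔n≤o⇒n≤o L N L⊔N≤i)))))

infixl 7 _÷_[_]

_÷_[_] : (x y : ℝ) → Positive y → ℝ
x ÷ y [ y>0 ] = x * reciprocal y y>0

sqrtSearch : ℚ → ℕ → ℕ → ℕ
sqrtSearch q k zero    = zero
sqrtSearch q k (suc t) =
  if does (((+ t) ℚ./ suc k) ² ℚ.<? q) then suc t else sqrtSearch q k t

-- The least multiple s ≥ 0 of 1/(k+1) with q ≤ s²: since q ≤ ∣↥ q∣², the search may
-- start from s = ∣↥ q∣. For q ≤ 0 the result is 0, so √ x is 0 when x is negative.
sqrtApprox : ℚ → ℕ → ℚ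
sqrtApprox q k = (+ sqrtSearch q k (ℤ.∣ ℚ.↥ q ∣ ℕ.* suc k)) ℚ./ suc k

/-mono : ∀ {a b c d} .{{_ : ℕ.NonZero b}} .{{_ : ℕ.NonZero d}} →
         a ℕ.* d ℕ.≤ c ℕ.* b → (+ a) ℚ./ b ℚ.≤ (+ c) ℚ./ d
/-mono {a} {b@(suc _)} {c} {d@(suc _)} h = ℚ.toℚᵘ-cancel-≤ (begin
  ℚ.toℚᵘ ((+ a) ℚ./ b)  ≃⟨ ℚ.toℚᵘ-fromℚᵘ ((+ a) ℚᵘ./ b) ⟩
  (+ a) ℚᵘ./ b          ≤⟨ ℚᵘ.*≤* (subst₂ ℤ._≤_ (ℤ.pos-* a d) (ℤ.pos-* c b) (ℤ.+≤+ h)) ⟩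
  (+ c) ℚᵘ./ d          ≃⟨ ℚ.toℚᵘ-fromℚᵘ ((+ c) ℚᵘ./ d) ⟨
  ℚ.toℚᵘ ((+ c) ℚ./ d)  ∎)
  where open ℚᵘ.≤-Reasoning

/-suc : ∀ t k → (+ suc t) ℚ./ suc k ≡ (+ t) ℚ./ suc k ℚ.+ (+ 1) ℚ./ suc k
/-suc t k = ℚ.toℚᵘ-injective (begin-equality
  ℚ.toℚᵘ ((+ suc t) ℚ./ d)                          ≃⟨ ℚ.toℚᵘ-fromℚᵘ ((+ suc t) ℚᵘ./ d) ⟩
  (+ suc t) ℚᵘ./ d                                  ≃⟨ ℚᵘ.*≡* eq ⟩
  (+ t) ℚᵘ./ d ℚᵘ.+ (+ 1) ℚᵘ./ d                    ≃⟨ ℚᵘ.+-cong (ℚ.toℚᵘ-fromℚᵘ ((+ t) ℚᵘ./ d)) (ℚ.toℚᵘ-fromℚᵘ ((+ 1) ℚᵘ./ d)) ⟨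
  ℚ.toℚᵘ ((+ t) ℚ./ d) ℚᵘ.+ ℚ.toℚᵘ ((+ 1) ℚ./ d)    ≃⟨ ℚ.toℚᵘ-homo-+ ((+ t) ℚ./ d) ((+ 1) ℚ./ d) ⟨
  ℚ.toℚᵘ ((+ t) ℚ./ d ℚ.+ (+ 1) ℚ./ d)              ∎)
  where
  open ℚᵘ.≤-Reasoning
  d = suc k
  eq : (+ suc t) ℤ.* (+ (d ℕ.* d)) ≡ ((+ t) ℤ.* (+ d) ℤ.+ (+ 1) ℤ.* (+ d)) ℤ.* (+ d)
  eq = trans (cong₂ ℤ._*_ (trans (cong +_ (ℕ.+-comm 1 t)) (ℤ.pos-+ t 1)) (ℤ.pos-* d d))
        (trans (sym (ℤ.*-assoc ((+ t) ℤ.+ (+ 1)) (+ d) (+ d)))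
               (cong (ℤ._* (+ d)) (ℤ.*-distribʳ-+ (+ d) (+ t) (+ 1))))

0≤/ : ∀ t k → 0ℚ ℚ.≤ (+ t) ℚ./ suc k
0≤/ t k = /-mono {0} {1} {t} {suc k} ℕ.z≤n

q≤∣↥q∣ : ∀ q → q ℚ.≤ (+ ℤ.∣ ℚ.↥ q ∣) ℚ./ 1
q≤∣↥q∣ q@(mkℚ _ _ _) = ℚ.≤-trans (p≤∣p∣ q) (subst (ℚ._≤ (+ n) ℚ./ 1) (ℚ.↥p/↧p≡p ∣ q ∣)
    (/-mono {n} {ℚ.↧ₙ q} {n} {1} (ℕ.*-monoʳ-≤ n (ℕ.>-nonZero⁻¹ (ℚ.↧ₙ q)))))
  where n = ℤ.∣ ℚ.↥ q ∣

archimedean : ∀ ε → 0ℚ ℚ.< ε → ∃[ N ] (∀ k → N ℕ.≤ k → (+ 1) ℚ./ suc k ℚ.≤ ε)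
archimedean ε@(mkℚ +[1+ n ] d _) _ = d , λ k d≤k →
  subst ((+ 1) ℚ./ suc k ℚ.≤_) (ℚ.↥p/↧p≡p ε)
    (/-mono {1} {suc k} {suc n} {suc d} (ℕ.*-mono-≤ (ℕ.s≤s (ℕ.z≤n {n})) (ℕ.s≤s d≤k)))
archimedean (mkℚ (+ 0) _ _) (ℚ.*<* (ℤ.+<+ ()))
archimedean (mkℚ -[1+ _ ] _ _) (ℚ.*<* ())

square-mono : ∀ {p q} → 0ℚ ℚ.≤ p → p ℚ.≤ q → p ² ℚ.≤ q ²
square-mono {p} {q} 0≤p p≤q = ℚ.≤-trans
  (ℚ.*-monoˡ-≤-nonNeg p {{ℚ.nonNegative 0≤p}} p≤q)
  (ℚ.*-monoʳ-≤-nonNeg q {{ℚ.nonNegative (ℚ.≤-trans 0≤p p≤q)}} p≤q)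

search-upper : ∀ q k t → q ℚ.≤ ((+ t) ℚ./ suc k) ² → q ℚ.≤ ((+ sqrtSearch q k t) ℚ./ suc k) ²
search-upper q k zero    h = h
search-upper q k (suc t) h = by (((+ t) ℚ./ suc k) ² ℚ.<? q)
  where
  by : (d : Dec (((+ t) ℚ./ suc k) ² ℚ.< q)) →
       q ℚ.≤ ((+ (if does d then suc t else sqrtSearch q k t)) ℚ./ suc k) ²
  by (yes _) = h
  by (no ≮q) = search-upper q k t (ℚ.≮⇒≥ ≮q)

search-lower : ∀ q k t → sqrtSearch q k t ≡ 0 ⊎
               (∃[ u ] sqrtSearch q k t ≡ suc u × ((+ u) ℚ./ suc k) ² ℚ.< q)
search-lower q k zero    = inj₁ refl
search-lower q k (suc t) = by (((+ t) ℚ./ suc k) ² ℚ.<? q)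
  where
  by : (d : Dec (((+ t) ℚ./ suc k) ² ℚ.< q)) →
       let r = if does d then suc t else sqrtSearch q k t in
       r ≡ 0 ⊎ (∃[ u ] r ≡ suc u × ((+ u) ℚ./ suc k) ² ℚ.< q)
  by (yes <q) = inj₂ (t , refl , <q)
  by (no  _)  = search-lower q k t

sqrtApprox-upper : ∀ q k → q ℚ.≤ (sqrtApprox q k) ²
sqrtApprox-upper q k = search-upper q k (n ℕ.* suc k)
  (ℚ.≤-trans (ℚ.≤-trans (q≤∣↥q∣ q) (n≤n² n)) (square-mono {(+ n) ℚ./ 1} {(+ (n ℕ.* suc k)) ℚ./ suc k} (0≤/ n 0)
    (/-mono {n} {1} {n ℕ.* suc k} {suc k} (ℕ.≤-reflexive (sym (ℕ.*-identityʳ (n ℕ.* suc k)))))))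
  where
  n = ℤ.∣ ℚ.↥ q ∣
  n≤n² : ∀ n → (+ n) ℚ./ 1 ℚ.≤ ((+ n) ℚ./ 1) ²
  n≤n² zero = ℚ.≤-refl
  n≤n² n@(suc _) = subst (ℚ._≤ ((+ n) ℚ./ 1) ²) (ℚ.*-identityʳ ((+ n) ℚ./ 1))
    (ℚ.*-monoˡ-≤-nonNeg ((+ n) ℚ./ 1) {{ℚ.nonNegative (0≤/ n 0)}}
      (/-mono {1} {1} {n} {1} (ℕ.s≤s ℕ.z≤n)))

sqrtApprox-nonNeg : ∀ q k → 0ℚ ℚ.≤ sqrtApprox q k
sqrtApprox-nonNeg q k = 0≤/ (sqrtSearch q k (ℤ.∣ ℚ.↥ q ∣ ℕ.* suc k)) k

sqrtApprox-close : ∀ {p q η} i j → 0ℚ ℚ.< η → p ℚ.< q ℚ.+ η ² →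
  sqrtApprox p i ℚ.< sqrtApprox q j ℚ.+ η ℚ.+ (+ 1) ℚ./ suc i
sqrtApprox-close {p} {q} {η} i j 0<η p<q+η² =
  case (search-lower p i (ℤ.∣ ℚ.↥ p ∣ ℕ.* suc i))
  where
  open ℚ.≤-Reasoning
  s = sqrtApprox q j
  0≤s = sqrtApprox-nonNeg q j
  0<s+η : 0ℚ ℚ.< s ℚ.+ η
  0<s+η = subst (ℚ._< s ℚ.+ η) (ℚ.+-identityˡ 0ℚ) (ℚ.+-mono-≤-< 0≤s 0<η)
  eq : ∀ s η → (s ℚ.+ η) ² ≡ s ² ℚ.+ η ² ℚ.+ (s ℚ.* η ℚ.+ s ℚ.* η)
  eq = solve 2 (λ s η → (s :+ η) :* (s :+ η) := s :* s :+ η :* η :+ (s :* η :+ s :* η)) refl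
    where open +-*-Solver
  0≤sη : 0ℚ ℚ.≤ s ℚ.* η
  0≤sη = subst (ℚ._≤ s ℚ.* η) (ℚ.*-zeroˡ η)
           (ℚ.*-monoʳ-≤-nonNeg η {{ℚ.nonNegative (ℚ.<⇒≤ 0<η)}} 0≤s)
  p<[s+η]² : p ℚ.< (s ℚ.+ η) ²
  p<[s+η]² = begin-strict
    p                                             <⟨ p<q+η² ⟩
    q ℚ.+ η ²                                     ≤⟨ ℚ.+-monoˡ-≤ (η ²) (sqrtApprox-upper q j) ⟩
    s ² ℚ.+ η ²                                   ≡⟨ ℚ.+-identityʳ (s ² ℚ.+ η ²) ⟨
    s ² ℚ.+ η ² ℚ.+ 0ℚ                            ≤⟨ ℚ.+-monoʳ-≤ (s ² ℚ.+ η ²) (ℚ.+-mono-≤ 0≤sη 0≤sη) ⟩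
    s ² ℚ.+ η ² ℚ.+ (s ℚ.* η ℚ.+ s ℚ.* η)         ≡⟨ eq s η ⟨
    (s ℚ.+ η) ²                                   ∎
  case : ∀ {t} → t ≡ 0 ⊎ (∃[ u ] t ≡ suc u × ((+ u) ℚ./ suc i) ² ℚ.< p) →
         (+ t) ℚ./ suc i ℚ.< s ℚ.+ η ℚ.+ (+ 1) ℚ./ suc i
  case (inj₁ refl) = begin-strict
    (+ 0) ℚ./ suc i                   ≤⟨ /-mono {0} {suc i} {0} {1} ℕ.z≤n ⟩
    0ℚ                                <⟨ 0<s+η ⟩
    s ℚ.+ η                           ≡⟨ ℚ.+-identityʳ (s ℚ.+ η) ⟨
    s ℚ.+ η ℚ.+ 0ℚ                    ≤⟨ ℚ.+-monoʳ-≤ (s ℚ.+ η) (0≤/ 1 i) ⟩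
    s ℚ.+ η ℚ.+ (+ 1) ℚ./ suc i       ∎
  case (inj₂ (u , refl , u²<p)) = begin-strict
    (+ suc u) ℚ./ suc i                       ≡⟨ /-suc u i ⟩
    (+ u) ℚ./ suc i ℚ.+ (+ 1) ℚ./ suc i       <⟨ ℚ.+-monoˡ-< ((+ 1) ℚ./ suc i)
                                                  (*-square-< {(+ u) ℚ./ suc i} {s ℚ.+ η} (ℚ.<⇒≤ 0<s+η)
                                                    (ℚ.<-trans u²<p p<[s+η]²)) ⟩
    s ℚ.+ η ℚ.+ (+ 1) ℚ./ suc i               ∎

√ : ℝ → ℝ
√ x = mkℝ (λ k → sqrtApprox (seq x k) k) cau
  where
  cau : ∀ ε → 0ℚ ℚ.< ε → ∃[ N ] (∀ i j → N ℕ.≤ i → N ℕ.≤ j →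
          ∣ sqrtApprox (seq x i) i ℚ.- sqrtApprox (seq x j) j ∣ ℚ.< ε)
  cau ε 0<ε =
    let η = ½ ℚ.* ε
        0<η = half-pos 0<ε
        M , hx = cauchy x (η ²) (*-pos {η} {η} 0<η 0<η)
        N , hN = archimedean η 0<η
        close : ∀ i j → M ℕ.⊔ N ℕ.≤ i → M ℕ.⊔ N ℕ.≤ j →
                sqrtApprox (seq x i) i ℚ.< sqrtApprox (seq x j) j ℚ.+ ε
        close i j p q = ℚ.<-≤-trans
          (sqrtApprox-close {seq x i} {seq x j} i j 0<η
            (p<q+ε (seq x i) (seq x j) (hx i j (ℕ.m⊔n≤o⇒m≤o M N p) (ℕ.m⊔n≤o⇒m≤o M N q))))
          (subst (sqrtApprox (seq x j) j ℚ.+ η ℚ.+ (+ 1) ℚ./ suc i ℚ.≤_)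
            (trans (ℚ.+-assoc (sqrtApprox (seq x j) j) η η)
                   (cong (sqrtApprox (seq x j) j ℚ.+_) (half+half ε)))
            (ℚ.+-monoʳ-≤ (sqrtApprox (seq x j) j ℚ.+ η) (hN i (ℕ.m⊔n≤o⇒n≤o M N p))))
    in M ℕ.⊔ N , λ i j p q → ∣p-q∣<ε (close i j p q) (close j i q p)

√x+1-positive : ∀ x → Positive (√ x + fromℤ (+ 1))
√x+1-positive x = 1ℚ , ℚ.positive⁻¹ 1ℚ , 0 , λ k _ →
  subst (ℚ._≤ sqrtApprox (seq x k) k ℚ.+ 1ℚ) (ℚ.+-identityˡ 1ℚ)
    (ℚ.+-monoˡ-≤ 1ℚ (sqrtApprox-nonNeg (seq x k) k))

{-# OPTIONS --safe #-}
module Submission where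

-- Order the vertices of G so that each one but the first has an earlier neighbour. At most
-- m − n + 1 vertices have two or more, and the others induce a forest on at least 2n − m − 1
-- vertices. Peeling off a leaf v with its neighbour p raises the skew-rank by 2 and puts v
-- into an independent set; peeling off an isolated vertex raises the independent set only.
-- Hence sr + 2α ≥ 2 (2n − m − 1). The α (α − 1) / 2 pairs inside an independent set are not
-- edges, hence (2α − 1)² ≤ 4n (n − 1) − 8m + 1. The two inequalities give the bound, and the
-- bound is attained iff both are equalities. In that case G is the join of an independent set
-- with a complete graph on k = n − α vertices, and the first equality leaves only k ≤ 1 (the
-- star) and k = 2, α = 1 (the triangle). Conversely the skew-adjacency matrix of these graphs
-- has the form e gᵀ − g eᵀ, so its rank is at most 2.

open import Data.Bool.Base using (if_then_else_; true; false)
open import Data.Nat using (ℕ; zero; suc)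
import Data.Nat as ℕ
import Data.Nat.Properties as ℕ
open import Data.Rational as ℚ using (ℚ; 0ℚ; 1ℚ; ∣_∣)
import Data.Rational.Properties as ℚ
open import Data.Rational.Solver using (module +-*-Solver)
open import Algebra.Properties.Monoid.Sum ℚ.+-0-monoid using () renaming (sum to ∑ℚ)
open import Data.Fin.Base as Fin using (Fin; toℕ)
import Data.Fin.Properties as Fin
open import Data.Fin.Patterns using (0F; 1F; 2F)
open import Data.Fin.Permutation using (transpose; ↔⇒≡)
open import Data.Fin.Subset as Subset using (Subset; ⁅_⁆; inside; outside; _∪_; ∁) renaming (∣_∣ to card)
open import Data.Fin.Subset.Properties using (_∈?_; ∣⁅x⁆∣≡1; x∈⁅y⁆⇒x≡y; x∈⁅x⁆; ∣⊥∣≡0; ∉⊥; p⊆p∪q; q⊆p∪q; x∈p∪q⁻; p⊂q⇒∣p∣<∣q∣; nonempty?; Empty-unique; ∣⊤∣≡n; ∣p∣≤n; ∣∁p∣≡n∸∣p∣; ∈⊤; ⊆⊤; x∉p⇒x∈∁p; x∈∁p⇒x∉p; x∉∁p⇒x∈p)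
open import Data.List.Base using (List; []; _∷_; [_]; _++_; length; map; filter; cartesianProduct; allFin; tabulate)
open import Data.List.Properties using (map-++; map-∘; map-tabulate; length-tabulate; ++-identityʳ)
open import Data.List.Membership.Propositional using (_∈_; _∉_; find; lose)
open import Data.List.Membership.Propositional.Properties using (∈-allFin; ∈-++⁻; ∈-++⁺ˡ; ∈-++⁺ʳ; ∈-∃++)
open import Data.List.Relation.Unary.Any using (here; there; any?)
open import Data.List.Relation.Unary.All as All using ([]; _∷_)
open import Data.List.Relation.Unary.AllPairs using ([]; _∷_)
open import Data.List.Relation.Unary.Unique.Propositional using (Unique)
open import Data.List.Relation.Unary.Unique.Propositional.Properties using (allFin⁺; Unique[x∷xs]⇒x∉xs)
open import Data.List.Relation.Binary.Permutation.Propositional using (_↭_; ↭-sym; ↭-trans; ↭-refl; ↭⇒↭ₛ)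
open import Data.List.Relation.Binary.Permutation.Propositional.Properties using (map⁺; shift; ↭-length; ∈-resp-↭; ++⁺ˡ)
import Data.List.Relation.Binary.Permutation.Setoid.Properties as ↭ₛ
open import Data.Product using (_×_; _,_; proj₁; proj₂; ∃-syntax)
open import Data.Sum as Sum using (_⊎_; inj₁; inj₂)
open import Data.Vec.Base using ([]; _∷_)
open import Function.Base using (_∘_; id)
open import Function.Bundles using (_⇔_; mk⇔; module Equivalence; module Inverse)
open import Function.Construct.Identity using (↔-id)
open import Relation.Binary.Definitions using (Tri; tri<; tri≈; tri>)
open import Relation.Binary.PropositionalEquality hiding ([_])
open import Relation.Nullary using (¬_; Dec; yes; no; does; contradiction)
open import Relation.Nullary.Decidable using (_×-dec_; dec-true)

module _ where

  open import Data.Nat using (_+_; _*_; _∸_; _≤_; _<_; _≤?_; z≤n; s≤s; NonZero; >-nonZero⁻¹)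
  open import Data.Nat.Properties
  open import Data.Nat.ListAction using (sum)
  open import Data.Nat.ListAction.Properties using (sum-↭; sum-++)
  open import Data.Nat.Tactic.RingSolver using (solve-∀)
  open import Relation.Binary.Construct.Closure.ReflexiveTransitive using (Star; ε; _◅_)
  open import Defs using (Graph; Adj; adj?; numEdges; Independent; Connected; Orientation; skewAdjacency; IsSkewRank; IsIndependenceNumber; Matrix; IsRank; _≅_; star; triangle; independenceNumber-nonZero)

  -- Finite sums

  𝟙 : ∀ {p} {P : Set p} → Dec P → ℕ
  𝟙 P? = if does P? then 1 else 0

  𝟙-yes : ∀ {p} {P : Set p} (P? : Dec P) → P → 𝟙 P? ≡ 1
  𝟙-yes (yes _) _ = refl
  𝟙-yes (no ¬p) p = contradiction p ¬p

  𝟙-no : ∀ {p} {P : Set p} (P? : Dec P) → ¬ P → 𝟙 P? ≡ 0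
  𝟙-no (yes p) ¬p = contradiction p ¬p
  𝟙-no (no _)  _  = refl

  𝟙≡1⇒ : ∀ {p} {P : Set p} (P? : Dec P) → 𝟙 P? ≡ 1 → P
  𝟙≡1⇒ (yes p) _ = p

  𝟙≤1 : ∀ {p} {P : Set p} (P? : Dec P) → 𝟙 P? ≤ 1
  𝟙≤1 (yes _) = ≤-refl
  𝟙≤1 (no _)  = z≤n

  module _ {a} {A : Set a} where

    ∑ : List A → (A → ℕ) → ℕ
    ∑ xs f = sum (map f xs)

    ∑-↭ : ∀ {xs ys} (f : A → ℕ) → xs ↭ ys → ∑ xs f ≡ ∑ ys f
    ∑-↭ f xs↭ys = sum-↭ (map⁺ f xs↭ys)

    ∑-cong : ∀ xs {f g : A → ℕ} → (∀ x → f x ≡ g x) → ∑ xs f ≡ ∑ xs g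
    ∑-cong []       f≗g = refl
    ∑-cong (x ∷ xs) f≗g = cong₂ _+_ (f≗g x) (∑-cong xs f≗g)

    ∑-mono : ∀ xs {f g : A → ℕ} → (∀ x → f x ≤ g x) → ∑ xs f ≤ ∑ xs g
    ∑-mono []       f≤g = z≤n
    ∑-mono (x ∷ xs) f≤g = +-mono-≤ (f≤g x) (∑-mono xs f≤g)

    ∑-distrib-+ : ∀ xs (f g : A → ℕ) → ∑ xs (λ x → f x + g x) ≡ ∑ xs f + ∑ xs g
    ∑-distrib-+ []       f g = refl
    ∑-distrib-+ (x ∷ xs) f g =
      trans (cong (f x + g x +_) (∑-distrib-+ xs f g)) (eq (f x) (g x) (∑ xs f) (∑ xs g))
      where
      eq : ∀ a b c d → a + b + (c + d) ≡ a + c + (b + d)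
      eq = solve-∀

    ∑-*ʳ : ∀ xs (f : A → ℕ) c → ∑ xs (λ x → f x * c) ≡ ∑ xs f * c
    ∑-*ʳ []       f c = refl
    ∑-*ʳ (x ∷ xs) f c = trans (cong (f x * c +_) (∑-*ʳ xs f c)) (sym (*-distribʳ-+ c (f x) (∑ xs f)))

    ∑-*ˡ : ∀ xs c (f : A → ℕ) → ∑ xs (λ x → c * f x) ≡ c * ∑ xs f
    ∑-*ˡ xs c f = trans (∑-cong xs (λ x → *-comm c (f x))) (trans (∑-*ʳ xs f c) (*-comm (∑ xs f) c))

    ∑-const : ∀ xs c → ∑ xs (λ _ → c) ≡ length xs * c
    ∑-const []       c = refl
    ∑-const (x ∷ xs) c = cong (c +_) (∑-const xs c)

    term≤∑ : ∀ {xs x} (f : A → ℕ) → x ∈ xs → f x ≤ ∑ xs f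
    term≤∑ {x ∷ xs} f (here refl)  = m≤m+n (f x) (∑ xs f)
    term≤∑ {x ∷ xs} f (there y∈xs) = ≤-trans (term≤∑ f y∈xs) (m≤n+m (∑ xs f) (f x))

    -- A strict gain of `g` over `f` at one member cannot be compensated at another. This turns
    -- equality between two double sums into equality at every pair.
    ∑-tight : ∀ {xs} {f g : A → ℕ} → (∀ x → f x ≤ g x) → ∑ xs g ≤ ∑ xs f →
              ∀ {x} → x ∈ xs → g x ≤ f x
    ∑-tight {x ∷ xs} {f} {g} f≤g g≤f (here refl) =
      +-cancelʳ-≤ (∑ xs f) (g x) (f x) (≤-trans (+-monoʳ-≤ (g x) (∑-mono xs f≤g)) g≤f)
    ∑-tight {x ∷ xs} {f} {g} f≤g g≤f (there y∈xs) =
      ∑-tight f≤g (+-cancelˡ-≤ (g x) (∑ xs g) (∑ xs f) (≤-trans g≤f (+-monoˡ-≤ (∑ xs f) (f≤g x)))) y∈xs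

    -- Two positions of value 1 would already sum to 2. A bound on the number of neighbours thereby
    -- becomes the uniqueness condition of `Forest`.
    ∑≤1⇒unique : ∀ {xs} {f : A → ℕ} → ∑ xs f ≤ 1 → ∀ {x y} → x ∈ xs → y ∈ xs →
                 f x ≡ 1 → f y ≡ 1 → x ≡ y
    ∑≤1⇒unique {_ ∷ xs} {f} ≤1 = by
      where
      clash : ∀ {x y} → f x ≡ 1 → f y ≡ 1 → y ∈ xs → ¬ (f x + ∑ xs f ≤ 1)
      clash fx fy y∈ ≤1 =
        1+n≰n (≤-trans (+-mono-≤ (≤-reflexive (sym fx)) (subst (_≤ ∑ xs f) fy (term≤∑ f y∈))) ≤1)
      by : ∀ {x y} → x ∈ _ ∷ xs → y ∈ _ ∷ xs → f x ≡ 1 → f y ≡ 1 → x ≡ y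
      by (here refl) (here refl) _  _  = refl
      by (here refl) (there y∈)  fx fy = contradiction ≤1 (clash fx fy y∈)
      by (there x∈)  (here refl) fx fy = contradiction ≤1 (clash fy fx x∈)
      by (there x∈)  (there y∈)  fx fy = ∑≤1⇒unique (≤-trans (m≤n+m (∑ xs f) _) ≤1) x∈ y∈ fx fy

    length-filter : ∀ {p} {P : A → Set p} (P? : ∀ x → Dec (P x)) xs →
                    length (filter P? xs) ≡ ∑ xs (𝟙 ∘ P?)
    length-filter P? []       = refl
    length-filter P? (x ∷ xs) with does (P? x)
    ... | true  = cong suc (length-filter P? xs)
    ... | false = length-filter P? xs

  module _ {a b} {A : Set a} {B : Set b} where

    ∑-comm : ∀ (xs : List A) (ys : List B) (f : A → B → ℕ) →
             ∑ xs (λ x → ∑ ys (f x)) ≡ ∑ ys (λ y → ∑ xs (λ x → f x y))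
    ∑-comm []       ys f = sym (trans (∑-const ys 0) (*-zeroʳ (length ys)))
    ∑-comm (x ∷ xs) ys f = trans (cong (∑ ys (f x) +_) (∑-comm xs ys f))
                                 (sym (∑-distrib-+ ys (f x) (λ y → ∑ xs (λ x → f x y))))

    ∑-cartesianProduct : ∀ (xs : List A) (ys : List B) (f : A × B → ℕ) →
      ∑ (cartesianProduct xs ys) f ≡ ∑ xs (λ x → ∑ ys (λ y → f (x , y)))
    ∑-cartesianProduct []       ys f = refl
    ∑-cartesianProduct (x ∷ xs) ys f = begin
      sum (map f (map (x ,_) ys ++ cartesianProduct xs ys))
        ≡⟨ cong sum (map-++ f (map (x ,_) ys) (cartesianProduct xs ys)) ⟩
      sum (map f (map (x ,_) ys) ++ map f (cartesianProduct xs ys))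
        ≡⟨ sum-++ (map f (map (x ,_) ys)) (map f (cartesianProduct xs ys)) ⟩
      sum (map f (map (x ,_) ys)) + ∑ (cartesianProduct xs ys) f
        ≡⟨ cong₂ _+_ (cong sum (sym (map-∘ ys))) (∑-cartesianProduct xs ys f) ⟩
      ∑ ys (λ y → f (x , y)) + ∑ xs (λ x → ∑ ys (λ y → f (x , y))) ∎
      where open ≡-Reasoning

  card≡∑ : ∀ {n} (I : Subset n) → card I ≡ ∑ (allFin n) (λ x → 𝟙 (x ∈? I))
  card≡∑ []      = refl
  card≡∑ (s ∷ I) = step s
    where
    rest : ∀ s → card I ≡ ∑ (tabulate Fin.suc) (λ x → 𝟙 (x ∈? (s ∷ I)))
    rest s = trans (card≡∑ I) (cong sum (trans (map-tabulate id (λ x → 𝟙 (x ∈? I)))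
                                               (sym (map-tabulate Fin.suc (λ x → 𝟙 (x ∈? (s ∷ I)))))))
    step : ∀ s → card (s ∷ I) ≡ ∑ (allFin _) (λ x → 𝟙 (x ∈? (s ∷ I)))
    step inside  = cong suc (rest inside)
    step outside = rest outside

  length-allFin : ∀ n → length (allFin n) ≡ n
  length-allFin n = length-tabulate (id {A = Fin n})

  -- Edge counts

  module _ {n} (G : Graph n) where

    private
      V : List (Fin n)
      V = allFin n

    adj : Fin n → Fin n → ℕ
    adj x y = 𝟙 (adj? G x y)

    adj-comm : ∀ x y → adj x y ≡ adj y x
    adj-comm x y with adj? G x y
    ... | yes x~y = sym (𝟙-yes (adj? G y x) (Graph.adj-sym G x~y))
    ... | no  x≁y = sym (𝟙-no (adj? G y x) (x≁y ∘ Graph.adj-sym G))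

    -- `numEdges` counts only pairs with `x` below `y`. Each adjacency splits by the order of its
    -- ends into `up x y` and `up y x`, and interchanging the sums makes the two halves equal.
    handshake : ∑ V (λ x → ∑ V (adj x)) ≡ 2 * numEdges G
    handshake = begin
      ∑ V (λ x → ∑ V (adj x))
        ≡⟨ ∑-cong V (λ x → trans (∑-cong V (split x)) (∑-distrib-+ V (up x) (λ y → up y x))) ⟩
      ∑ V (λ x → ∑ V (up x) + ∑ V (λ y → up y x))
        ≡⟨ ∑-distrib-+ V (λ x → ∑ V (up x)) (λ x → ∑ V (λ y → up y x)) ⟩
      ∑ V (λ x → ∑ V (up x)) + ∑ V (λ x → ∑ V (λ y → up y x))
        ≡⟨ cong (∑ V (λ x → ∑ V (up x)) +_) (∑-comm V V (λ x y → up y x)) ⟩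
      ∑ V (λ x → ∑ V (up x)) + ∑ V (λ x → ∑ V (up x))
        ≡⟨ cong₂ _+_ up≡m (trans up≡m (sym (+-identityʳ (numEdges G)))) ⟩
      2 * numEdges G ∎
      where
      open ≡-Reasoning
      up? : ∀ x y → Dec (x Fin.< y × Adj G x y)
      up? x y = (x Fin.<? y) ×-dec adj? G x y
      up : Fin n → Fin n → ℕ
      up x y = 𝟙 (up? x y)
      up≡m : ∑ V (λ x → ∑ V (up x)) ≡ numEdges G
      up≡m = sym (trans (length-filter _ (cartesianProduct V V)) (∑-cartesianProduct V V _))
      split : ∀ x y → adj x y ≡ up x y + up y x
      split x y = by (adj? G x y)
        where
        by : Dec (Adj G x y) → adj x y ≡ up x y + up y x
        by (no x≁y) = trans (𝟙-no (adj? G x y) x≁y)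
          (sym (cong₂ _+_ (𝟙-no (up? x y) (x≁y ∘ proj₂)) (𝟙-no (up? y x) (x≁y ∘ Graph.adj-sym G ∘ proj₂))))
        by (yes x~y) = trans (𝟙-yes (adj? G x y) x~y) (sym (orient (Fin.<-cmp x y)))
          where
          orient : Tri (x Fin.< y) (x ≡ y) (y Fin.< x) → up x y + up y x ≡ 1
          orient (tri< x<y _ x≯y) = cong₂ _+_ (𝟙-yes (up? x y) (x<y , x~y)) (𝟙-no (up? y x) (x≯y ∘ proj₁))
          orient (tri≈ _ x≡y _)   = contradiction x~y (Graph.adj-irrefl G x≡y)
          orient (tri> x≮y _ y<x) =
            cong₂ _+_ (𝟙-no (up? x y) (x≮y ∘ proj₁)) (𝟙-yes (up? y x) (y<x , Graph.adj-sym G x~y))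

    module _ (I : Subset n) (indep : Independent G I) where

      private
        ι : Fin n → ℕ
        ι x = 𝟙 (x ∈? I)
        -- The Kronecker delta, written as membership in a singleton so that its row sums are values
        -- of `card`.
        δ : Fin n → Fin n → ℕ
        δ x y = 𝟙 (y ∈? ⁅ x ⁆)
        -- Off the diagonal, `lhs x y ≤ rhs x y` says that a pair cannot be both an edge and inside
        -- `I`; on the diagonal both sides equal `1 + ι x`. Summing over all ordered pairs gives
        -- `edges-bound`.
        lhs rhs : Fin n → Fin n → ℕ
        lhs x y = adj x y + δ x y + ι x * ι y
        rhs x y = 1 + ι x * δ x y

        lhs≤rhs : ∀ x y → lhs x y ≤ rhs x y
        lhs≤rhs x y with y ∈? ⁅ x ⁆
        lhs≤rhs x y | yes y∈ with refl ← x∈⁅y⁆⇒x≡y x y∈ rewrite 𝟙-no (adj? G x x) (Graph.adj-irrefl G refl)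
          with x ∈? I
        ... | yes _ = ≤-refl
        ... | no  _ = ≤-refl
        lhs≤rhs x y | no _ with x ∈? I | y ∈? I
        ... | yes x∈ | yes y∈ rewrite 𝟙-no (adj? G x y) (indep x∈ y∈) = ≤-refl
        ... | yes _  | no _ = subst (_≤ 1) (sym (trans (+-identityʳ _) (+-identityʳ _))) (𝟙≤1 (adj? G x y))
        ... | no _   | _    = subst (_≤ 1) (sym (trans (+-identityʳ _) (+-identityʳ _))) (𝟙≤1 (adj? G x y))

        ∑δ : ∀ x → ∑ V (δ x) ≡ 1
        ∑δ x = trans (sym (card≡∑ ⁅ x ⁆)) (∣⁅x⁆∣≡1 x)

        ∑lhs : ∑ V (λ x → ∑ V (lhs x)) ≡ 2 * numEdges G + n + card I * card I
        ∑lhs = begin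
          ∑ V (λ x → ∑ V (lhs x))
            ≡⟨ ∑-cong V (λ x → trans (∑-distrib-+ V (λ y → adj x y + δ x y) (λ y → ι x * ι y))
                                     (cong₂ _+_ (∑-distrib-+ V (adj x) (δ x)) (∑-*ˡ V (ι x) ι))) ⟩
          ∑ V (λ x → ∑ V (adj x) + ∑ V (δ x) + ι x * ∑ V ι)
            ≡⟨ trans (∑-distrib-+ V (λ x → ∑ V (adj x) + ∑ V (δ x)) (λ x → ι x * ∑ V ι))
                     (cong₂ _+_ (∑-distrib-+ V (λ x → ∑ V (adj x)) (λ x → ∑ V (δ x))) (∑-*ʳ V ι (∑ V ι))) ⟩
          ∑ V (λ x → ∑ V (adj x)) + ∑ V (λ x → ∑ V (δ x)) + ∑ V ι * ∑ V ι
            ≡⟨ cong₂ _+_ (cong₂ _+_ handshake (trans (∑-cong V ∑δ) (trans (∑-const V 1)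
                 (trans (*-identityʳ _) (length-allFin n)))))
                 (sym (cong₂ _*_ (card≡∑ I) (card≡∑ I))) ⟩
          2 * numEdges G + n + card I * card I ∎
          where open ≡-Reasoning

        ∑rhs : ∑ V (λ x → ∑ V (rhs x)) ≡ n * n + card I
        ∑rhs = begin
          ∑ V (λ x → ∑ V (rhs x))
            ≡⟨ ∑-cong V (λ x → trans (∑-distrib-+ V (λ _ → 1) (λ y → ι x * δ x y))
                 (cong₂ _+_ ∑1 (trans (∑-*ˡ V (ι x) (δ x)) (trans (cong (ι x *_) (∑δ x)) (*-identityʳ (ι x)))))) ⟩
          ∑ V (λ x → n + ι x)
            ≡⟨ ∑-distrib-+ V (λ _ → n) ι ⟩
          ∑ V (λ _ → n) + ∑ V ι
            ≡⟨ cong₂ _+_ (trans (∑-const V n) (cong (_* n) (length-allFin n))) (sym (card≡∑ I)) ⟩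
          n * n + card I ∎
          where
          open ≡-Reasoning
          ∑1 : ∑ V (λ _ → 1) ≡ n
          ∑1 = trans (∑-const V 1) (trans (*-identityʳ _) (length-allFin n))

      -- Multiplied by 4 and rearranged, this is (2a - 1)² ≤ 4n(n - 1) - 8m + 1 with a = `card I`;
      -- the present form avoids subtraction.
      edges-bound : 2 * numEdges G + n + card I * card I ≤ n * n + card I
      edges-bound = subst₂ _≤_ ∑lhs ∑rhs (∑-mono V (λ x → ∑-mono V (lhs≤rhs x)))

      -- Equal double sums force `lhs` and `rhs` to agree at each pair. Where the delta and the
      -- product of indicators vanish, only the adjacency term can supply the required 1.
      edges-tight : 2 * numEdges G + n + card I * card I ≡ n * n + card I →
                    ∀ {x y} → x ≢ y → ¬ (x Subset.∈ I × y Subset.∈ I) → Adj G x y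
      edges-tight eq {x} {y} x≢y ¬xy∈I = 𝟙≡1⇒ (adj? G x y) (≤-antisym (𝟙≤1 (adj? G x y)) 1≤adj)
        where
        pointwise : rhs x y ≤ lhs x y
        pointwise = ∑-tight (lhs≤rhs x)
          (∑-tight (λ x → ∑-mono V (lhs≤rhs x)) (≤-reflexive (trans ∑rhs (sym (trans ∑lhs eq)))) (∈-allFin x))
          (∈-allFin y)
        δ≡0 : δ x y ≡ 0
        δ≡0 = 𝟙-no (y ∈? ⁅ x ⁆) (λ y∈ → x≢y (sym (x∈⁅y⁆⇒x≡y x y∈)))
        ιι≡0 : ι x * ι y ≡ 0
        ιι≡0 with x ∈? I | y ∈? I
        ... | yes x∈ | yes y∈ = contradiction (x∈ , y∈) ¬xy∈I
        ... | yes _  | no _   = refl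
        ... | no _   | _      = refl
        1≤adj : 1 ≤ adj x y
        1≤adj = begin
          1                          ≤⟨ m≤m+n 1 _ ⟩
          rhs x y                    ≤⟨ pointwise ⟩
          lhs x y                    ≡⟨ cong₂ (λ a b → adj x y + a + b) δ≡0 ιι≡0 ⟩
          adj x y + 0 + 0            ≡⟨ trans (+-identityʳ _) (+-identityʳ _) ⟩
          adj x y                    ∎
          where open ≤-Reasoning

      -- The hypothesis makes the pointwise inequality an equality everywhere. The edge counts of
      -- the star and of the triangle are read off from here.
      edges-split : (∀ {x y} → x ≢ y → ¬ (x Subset.∈ I × y Subset.∈ I) → Adj G x y) →
                    2 * numEdges G + n + card I * card I ≡ n * n + card I
      edges-split split = trans (sym ∑lhs) (trans (∑-cong V (λ x → ∑-cong V (λ y → ≤-antisym (lhs≤rhs x y) (rhs≤lhs x y)))) ∑rhs)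
        where
        adj≥1 : ∀ {x y k} → Adj G x y → 1 ≤ adj x y + 0 + k
        adj≥1 {x} {y} x~y rewrite 𝟙-yes (adj? G x y) x~y = s≤s z≤n
        rhs≤lhs : ∀ x y → rhs x y ≤ lhs x y
        rhs≤lhs x y with y ∈? ⁅ x ⁆
        rhs≤lhs x y | yes y∈ with refl ← x∈⁅y⁆⇒x≡y x y∈ rewrite 𝟙-no (adj? G x x) (Graph.adj-irrefl G refl)
          with x ∈? I
        ... | yes _ = ≤-refl
        ... | no  _ = ≤-refl
        rhs≤lhs x y | no y∉ with x ∈? I | y ∈? I
        ... | yes x∈ | yes _ = m≤n+m 1 _
        ... | yes _  | no y∉I = adj≥1 (split (λ { refl → y∉ (x∈⁅x⁆ x) }) (y∉I ∘ proj₂))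
        ... | no x∉I | _      = adj≥1 (split (λ { refl → y∉ (x∈⁅x⁆ x) }) (x∉I ∘ proj₁))

  -- Induced forests

  Unique-resp-↭ : ∀ {a} {A : Set a} {xs ys : List A} → xs ↭ ys → Unique xs → Unique ys
  Unique-resp-↭ {A = A} p = ↭ₛ.Unique-resp-↭ (setoid A) (↭⇒↭ₛ p)

  ∈-++-∷⁺ : ∀ {a} {A : Set a} (xs : List A) {x y ys} → x ∈ xs ++ ys → x ∈ xs ++ y ∷ ys
  ∈-++-∷⁺ xs x∈ with ∈-++⁻ xs x∈
  ... | inj₁ x∈xs = ∈-++⁺ˡ x∈xs
  ... | inj₂ x∈ys = ∈-++⁺ʳ xs (there x∈ys)

  module _ {n} (G : Graph n) where

    private
      V : List (Fin n)
      V = allFin n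
      a = adj G

    -- The diagonal entry is zero, and by symmetry the new row and the new column contribute the
    -- same amount.
    ∑∑-adj-∷ : ∀ v xs → ∑ (v ∷ xs) (λ x → ∑ (v ∷ xs) (a x)) ≡ 2 * ∑ xs (a v) + ∑ xs (λ x → ∑ xs (a x))
    ∑∑-adj-∷ v xs = begin
      a v v + ∑ xs (a v) + ∑ xs (λ x → a x v + ∑ xs (a x))
        ≡⟨ cong₂ (λ k l → k + ∑ xs (a v) + l) (𝟙-no (adj? G v v) (Graph.adj-irrefl G refl))
             (trans (∑-distrib-+ xs (λ x → a x v) (λ x → ∑ xs (a x)))
                    (cong (_+ ∑ xs (λ x → ∑ xs (a x))) (∑-cong xs (λ x → adj-comm G x v)))) ⟩
      ∑ xs (a v) + (∑ xs (a v) + ∑ xs (λ x → ∑ xs (a x)))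
        ≡⟨ eq (∑ xs (a v)) _ ⟩
      2 * ∑ xs (a v) + ∑ xs (λ x → ∑ xs (a x)) ∎
      where
      open ≡-Reasoning
      eq : ∀ p q → p + (p + q) ≡ 2 * p + q
      eq = solve-∀

    -- The newest vertex stands at the head, so its earlier neighbour lies in the tail and the root
    -- comes last.
    data Grown : List (Fin n) → Set where
      root : ∀ v → Grown [ v ]
      grow : ∀ {u v xs} → u ∈ xs → Adj G v u → Grown xs → Grown (v ∷ xs)

    -- Along the walk from `u`, the first vertex outside `xs` lies in `ys` and its predecessor in
    -- `xs`. The walk cannot end before that, because `xs` and `ys` are disjoint.
    crossing : ∀ {xs ys} → Unique (xs ++ ys) → (∀ x → x ∈ xs ++ ys) → ∀ {u w} → Star (Adj G) u w →
               u ∈ xs → w ∈ ys → ∃[ x ] ∃[ y ] x ∈ xs × y ∈ ys × Adj G y x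
    crossing {xs} {ys} uniq all ε u∈xs u∈ys = contradiction u∈ys (disjoint xs uniq u∈xs)
      where
      disjoint : ∀ xs → Unique (xs ++ ys) → ∀ {u} → u ∈ xs → u ∉ ys
      disjoint (x ∷ xs) uniq       (here refl)  u∈ys = Unique[x∷xs]⇒x∉xs uniq (∈-++⁺ʳ xs u∈ys)
      disjoint (x ∷ xs) (_ ∷ uniq) (there u∈xs) u∈ys = disjoint xs uniq u∈xs u∈ys
    crossing {xs} uniq all (_◅_ {j = v} u~v v⟶w) u∈xs w∈ys with ∈-++⁻ xs (all v)
    ... | inj₁ v∈xs = crossing uniq all v⟶w v∈xs w∈ys
    ... | inj₂ v∈ys = _ , v , u∈xs , v∈ys , Graph.adj-sym G u~v

    -- Growth of a spanning tree: as long as a vertex is missing, connectedness provides an edge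
    -- that leaves the part already ordered.
    grown-ordering : Connected G → ∃[ xs ] Grown xs × xs ↭ V
    grown-ordering (nz , path) = start V ↭-refl (subst NonZero (sym (length-allFin n)) nz)
      where
      -- The recursion is on the number `k` of missing vertices: the next vertex is taken from the
      -- middle of `ys`, so `as ++ bs` is not a subterm of it.
      extend : ∀ k xs ys → length ys ≡ k → Grown xs → xs ++ ys ↭ V → ∃[ xs ] Grown xs × xs ↭ V
      extend zero    xs [] _ g p = xs , g , subst (_↭ V) (++-identityʳ xs) p
      extend (suc k) xs (w ∷ ys) len g p
        with crossing (Unique-resp-↭ (↭-sym p) (allFin⁺ n)) (λ x → ∈-resp-↭ (↭-sym p) (∈-allFin x))
                      (path (proj₁ (member g)) w) (proj₂ (member g)) (here refl)
        where
        member : ∀ {xs} → Grown xs → ∃[ u ] u ∈ xs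
        member (root v)     = v , here refl
        member (grow _ _ _) = _ , here refl
      ... | u , v , u∈xs , v∈ys , v~u with as , bs , ys≡ ← ∈-∃++ v∈ys =
        extend k (v ∷ xs) (as ++ bs) (suc-injective (trans (↭-length (↭-sym split)) len)) (grow u∈xs v~u g)
          (↭-trans (↭-sym (shift v xs (as ++ bs))) (↭-trans (++⁺ˡ xs (↭-sym split)) p))
        where
        split : w ∷ ys ↭ v ∷ as ++ bs
        split = subst (_↭ v ∷ as ++ bs) (sym ys≡) (shift v as bs)
      start : ∀ xs → xs ↭ V → NonZero (length xs) → ∃[ xs ] Grown xs × xs ↭ V
      start (v ∷ ys) p _ = extend (length ys) [ v ] ys refl (root v) p

    -- A forest is presented by an order in which vertices are removed as leaves or isolated vertices.
    data Forest : List (Fin n) → Set where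
      []  : Forest []
      _∷_ : ∀ {v xs} → (∀ {y z} → y ∈ xs → z ∈ xs → Adj G v y → Adj G v z → y ≡ z) →
            Forest xs → Forest (v ∷ xs)

    -- Having at most one later neighbour survives the deletion of a later vertex. It is applied
    -- when a leaf takes its neighbour `p` away with it.
    forest-remove : ∀ as {p bs} → Forest (as ++ p ∷ bs) → Forest (as ++ bs)
    forest-remove []       (_ ∷ F) = F
    forest-remove (v ∷ as) {p} {bs} (h ∷ F) = (λ y∈ z∈ → h (weaken y∈) (weaken z∈)) ∷ forest-remove as F
      where
      weaken : ∀ {y} → y ∈ as ++ bs → y ∈ as ++ p ∷ bs
      weaken = ∈-++-∷⁺ as

    private
      -- Here `j` is 1 if `v` is kept and 0 if it is dropped. The left side grows by 4, the right
      -- side by twice `j` plus twice the number of neighbours of `v` in `xs`.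
      step : ∀ v xs w j → 2 ≤ j + ∑ xs (a v) → 4 * length xs ≤ 2 * w + ∑ xs (λ x → ∑ xs (a x)) + 2 →
             4 * length (v ∷ xs) ≤ 2 * (j + w) + ∑ (v ∷ xs) (λ x → ∑ (v ∷ xs) (a x)) + 2
      step v xs w j 2≤j+d bound = begin
        4 * suc (length xs)                       ≡⟨ *-suc 4 (length xs) ⟩
        2 * 2 + 4 * length xs                     ≤⟨ +-mono-≤ (*-monoʳ-≤ 2 2≤j+d) bound ⟩
        2 * (j + ∑ xs (a v)) + (2 * w + S + 2)    ≡⟨ eq j (∑ xs (a v)) w S ⟩
        2 * (j + w) + (2 * ∑ xs (a v) + S) + 2    ≡⟨ cong (λ k → 2 * (j + w) + k + 2) (∑∑-adj-∷ v xs) ⟨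
        2 * (j + w) + ∑ (v ∷ xs) (λ x → ∑ (v ∷ xs) (a x)) + 2 ∎
        where
        open ≤-Reasoning
        S = ∑ xs (λ x → ∑ xs (a x))
        eq : ∀ j d w S → 2 * (j + d) + (2 * w + S + 2) ≡ 2 * (j + w) + (2 * d + S) + 2
        eq = solve-∀

    -- Dropping every vertex with two neighbours after it costs at most one vertex per edge
    -- outside the spanning tree given by the ordering.
    induced-forest : ∀ {xs} → Grown xs → Unique xs →
      ∃[ ws ] (∀ {x} → x ∈ ws → x ∈ xs) × Unique ws × Forest ws ×
        4 * length xs ≤ 2 * length ws + ∑ xs (λ x → ∑ xs (a x)) + 2
    -- The constant 2 of the bound is fixed here: one kept vertex without edges gives 4 on both
    -- sides.
    induced-forest (root v) uniq = [ v ] , id , uniq , (λ ()) ∷ [] , +-monoˡ-≤ 2 (m≤m+n 2 _)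
    induced-forest {v ∷ xs} (grow {u} u∈xs v~u g) (v∉xs ∷ uniq)
      with ws , ws⊆xs , uniqW , F , bound ← induced-forest g uniq | ∑ xs (a v) ≤? 1
    ... | yes d≤1 = v ∷ ws , (λ { (here eq) → here eq ; (there x∈) → there (ws⊆xs x∈) }) ,
          All.tabulate (λ x∈ → All.lookup v∉xs (ws⊆xs x∈)) ∷ uniqW ,
          (λ y∈ z∈ v~y v~z → ∑≤1⇒unique d≤1 (ws⊆xs y∈) (ws⊆xs z∈) (𝟙-yes (adj? G v _) v~y) (𝟙-yes (adj? G v _) v~z)) ∷ F ,
          -- Keeping `v` supplies 1, and its edge to the earlier neighbour `u` the other 1.
          step v xs (length ws) 1 (s≤s d≥1) bound
      where
      d≥1 : 1 ≤ ∑ xs (a v)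
      d≥1 = subst (_≤ ∑ xs (a v)) (𝟙-yes (adj? G v u) v~u) (term≤∑ (a v) u∈xs)
    ... | no d≰1 = ws , there ∘ ws⊆xs , uniqW , F , step v xs (length ws) 0 (≰⇒> d≰1) bound

  -- The skew-rank

  ∑ℚ-zero : ∀ {k} {t : Fin k → ℚ} → (∀ i → t i ≡ 0ℚ) → ∑ℚ t ≡ 0ℚ
  ∑ℚ-zero {zero}  t≡0 = refl
  ∑ℚ-zero {suc k} t≡0 = trans (cong₂ ℚ._+_ (t≡0 0F) (∑ℚ-zero (t≡0 ∘ Fin.suc))) (ℚ.+-identityʳ 0ℚ)

  module _ {n} {G : Graph n} (σ : Orientation G) where

    open Orientation σ

    private
      M : Matrix n n
      M = skewAdjacency σ

    skew-nonadjacent : ∀ {x y} → ¬ Adj G x y → M x y ≡ 0ℚ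
    skew-nonadjacent {x} {y} x≁y with arc? x y | arc? y x
    ... | yes x→y | _       = contradiction (arc⇒adj x→y) x≁y
    ... | no _    | yes y→x = contradiction (Graph.adj-sym G (arc⇒adj y→x)) x≁y
    ... | no _    | no _    = refl

    skew-diagonal : ∀ x → M x x ≡ 0ℚ
    skew-diagonal x = skew-nonadjacent (Graph.adj-irrefl G refl)

    skew-antisym : ∀ x y → M y x ≡ ℚ.- M x y
    skew-antisym x y with arc? x y | arc? y x
    ... | yes x→y | yes y→x = contradiction y→x (asym x→y)
    ... | yes _   | no _    = refl
    ... | no _    | yes _   = refl
    ... | no _    | no _    = refl

    skew-square : ∀ {x y} → Adj G x y → M x y ℚ.* M x y ≡ 1ℚ
    skew-square {x} {y} x~y with arc? x y | arc? y x
    ... | yes _   | _       = refl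
    ... | no _    | yes _   = refl
    ... | no x↛y | no y↛x with adj⇒arc x~y
    ...   | inj₁ x→y = contradiction x→y x↛y
    ...   | inj₂ y→x = contradiction y→x y↛x

    -- The entry at an edge is 1 or -1, hence its own inverse, and a second multiplication by it
    -- undoes the first.
    skew-cancel : ∀ {x y} c → Adj G x y → c ℚ.* M x y ≡ 0ℚ → c ≡ 0ℚ
    skew-cancel {x} {y} c x~y cM≡0 = begin
      c                          ≡⟨ ℚ.*-identityʳ c ⟨
      c ℚ.* 1ℚ                   ≡⟨ cong (c ℚ.*_) (skew-square x~y) ⟨
      c ℚ.* (M x y ℚ.* M x y)    ≡⟨ ℚ.*-assoc c (M x y) (M x y) ⟨
      c ℚ.* M x y ℚ.* M x y      ≡⟨ cong (ℚ._* M x y) cM≡0 ⟩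
      0ℚ ℚ.* M x y               ≡⟨ ℚ.*-zeroˡ (M x y) ⟩
      0ℚ                         ∎
      where open ≡-Reasoning

    -- Independence is tested on the rows in `xs` only, so it concerns the principal submatrix on
    -- `xs`. Further rows preserve it, which gives a lower bound for the rank of the whole matrix.
    record Columns (xs : List (Fin n)) (k : ℕ) : Set where
      field
        col    : Fin k → Fin n
        col∈   : ∀ i → col i ∈ xs
        indep  : ∀ (c : Fin k → ℚ) → (∀ {x} → x ∈ xs → ∑ℚ (λ i → c i ℚ.* M x (col i)) ≡ 0ℚ) → ∀ i → c i ≡ 0ℚ

    no-columns : ∀ {xs} → Columns xs 0
    no-columns = record { col = λ () ; col∈ = λ () ; indep = λ _ _ () }

    private
      drop-zero-terms : ∀ {a b c} → b ≡ 0ℚ → c ≡ 0ℚ → a ℚ.+ (b ℚ.+ c) ≡ 0ℚ → a ≡ 0ℚ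
      drop-zero-terms {a} refl refl eq = trans (sym (ℚ.+-identityʳ a)) eq

    -- Row v is supported on column p, and column v on row p, so both can be eliminated.
    columns-pair : ∀ {xs ys v p k} → (∀ {y} → y ∈ ys → y ∈ xs) → p ∈ xs → Adj G v p →
                   (∀ {y} → y ∈ ys → ¬ Adj G v y) → Columns ys k → Columns (v ∷ xs) (2 + k)
    columns-pair {xs} {ys} {v} {p} {k} ys⊆xs p∈xs v~p v≁ys C = record
      { col   = col′
      ; col∈  = λ { 0F → here refl ; 1F → there p∈xs ; (Fin.suc (Fin.suc i)) → there (ys⊆xs (C.col∈ i)) }
      ; indep = indep′
      }
      where
      module C = Columns C
      col′ : Fin (2 + k) → Fin n
      col′ 0F                    = v
      col′ 1F                    = p
      col′ (Fin.suc (Fin.suc i)) = C.col i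
      *0 : ∀ a {b} → b ≡ 0ℚ → a ℚ.* b ≡ 0ℚ
      *0 a refl = ℚ.*-zeroʳ a
      0* : ∀ {a} b → a ≡ 0ℚ → a ℚ.* b ≡ 0ℚ
      0* b refl = ℚ.*-zeroˡ b
      rotate : ∀ a b c → a ℚ.+ (b ℚ.+ c) ≡ c ℚ.+ (a ℚ.+ b)
      rotate = solve 3 (λ a b c → a :+ (b :+ c) := c :+ (a :+ b)) refl where open +-*-Solver
      exchange : ∀ a b c → a ℚ.+ (b ℚ.+ c) ≡ b ℚ.+ (a ℚ.+ c)
      exchange = solve 3 (λ a b c → a :+ (b :+ c) := b :+ (a :+ c)) refl where open +-*-Solver
      indep′ : ∀ (c : Fin (2 + k) → ℚ) → (∀ {x} → x ∈ v ∷ xs → ∑ℚ (λ i → c i ℚ.* M x (col′ i)) ≡ 0ℚ) → ∀ i → c i ≡ 0ℚ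
      indep′ c rows = λ { 0F → c₀ ; 1F → c₁ ; (Fin.suc (Fin.suc i)) → c₂ i }
        where
        tail : Fin n → ℚ
        tail x = ∑ℚ (λ i → c (Fin.suc (Fin.suc i)) ℚ.* M x (C.col i))
        -- Order of elimination: row `v` kills the coefficient of column `p`, the rows in `ys` then
        -- kill those of `C`, and row `p` finally kills that of column `v`.
        c₁ : c 1F ≡ 0ℚ
        c₁ = skew-cancel (c 1F) v~p (drop-zero-terms (*0 (c 0F) (skew-diagonal v))
               (∑ℚ-zero (λ i → *0 (c (Fin.suc (Fin.suc i))) (skew-nonadjacent (v≁ys (C.col∈ i)))))
               (trans (sym (exchange (c 0F ℚ.* M v v) (c 1F ℚ.* M v p) (tail v))) (rows (here refl))))
        c₂ : ∀ i → c (Fin.suc (Fin.suc i)) ≡ 0ℚ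
        c₂ = C.indep (λ i → c (Fin.suc (Fin.suc i))) (λ {x} x∈ys →
               drop-zero-terms (*0 (c 0F) (skew-nonadjacent (v≁ys x∈ys ∘ Graph.adj-sym G))) (0* (M x p) c₁)
                 (trans (sym (rotate (c 0F ℚ.* M x v) (c 1F ℚ.* M x p) (tail x))) (rows (there (ys⊆xs x∈ys)))))
        c₀ : c 0F ≡ 0ℚ
        c₀ = skew-cancel (c 0F) (Graph.adj-sym G v~p) (drop-zero-terms (0* (M p p) c₁)
               (∑ℚ-zero (λ i → 0* (M p (C.col i)) (c₂ i))) (rows (there p∈xs)))

    columns-weaken : ∀ {xs ys k} → (∀ {y} → y ∈ ys → y ∈ xs) → Columns ys k → Columns xs k
    columns-weaken ys⊆xs C = record
      { col   = C.col
      ; col∈  = ys⊆xs ∘ C.col∈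
      ; indep = λ c rows → C.indep c (rows ∘ ys⊆xs)
      }
      where module C = Columns C

    columns≤rank : ∀ {xs k r} → IsSkewRank σ r → Columns xs k → k ≤ r
    columns≤rank (_ , max) C = max _ C.col (λ c rows → C.indep c (λ {x} _ → rows x))
      where module C = Columns C

    edge⇒rank≥2 : ∀ {x y r} → Adj G x y → IsSkewRank σ r → 2 ≤ r
    edge⇒rank≥2 {x} {y} x~y isRank =
      columns≤rank isRank (columns-pair {xs = [ y ]} {ys = []} (λ ()) (here refl) x~y (λ ()) no-columns)

    -- Rank and independent sets of forests

    record Peeling (xs : List (Fin n)) : Set where
      field
        {rank}  : ℕ
        columns : Columns xs rank
        set     : Subset n
        set⊆    : ∀ {x} → x Subset.∈ set → x ∈ xs
        indep   : Independent G set
        bound   : 2 * length xs ≤ rank + 2 * card set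

    private
      add-isolated : ∀ {v} (I : Subset n) → Independent G I → (∀ {x} → x Subset.∈ I → ¬ Adj G v x) →
                     v Subset.∉ I → Independent G (I ∪ ⁅ v ⁆) × card I < card (I ∪ ⁅ v ⁆)
      add-isolated {v} I ind v≁I v∉I = ind′ , p⊂q⇒∣p∣<∣q∣ (p⊆p∪q ⁅ v ⁆ , v , q⊆p∪q I ⁅ v ⁆ (x∈⁅x⁆ v) , v∉I)
        where
        ind′ : Independent G (I ∪ ⁅ v ⁆)
        ind′ x∈ y∈ with x∈p∪q⁻ I ⁅ v ⁆ x∈ | x∈p∪q⁻ I ⁅ v ⁆ y∈
        ... | inj₁ x∈I | inj₁ y∈I = ind x∈I y∈I
        ... | inj₁ x∈I | inj₂ y∈v with refl ← x∈⁅y⁆⇒x≡y v y∈v = v≁I x∈I ∘ Graph.adj-sym G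
        ... | inj₂ x∈v | inj₁ y∈I with refl ← x∈⁅y⁆⇒x≡y v x∈v = v≁I y∈I
        ... | inj₂ x∈v | inj₂ y∈v =
          Graph.adj-irrefl G (trans (x∈⁅y⁆⇒x≡y v x∈v) (sym (x∈⁅y⁆⇒x≡y v y∈v)))

      ∪-⊆ : ∀ {v xs} (I : Subset n) → (∀ {x} → x Subset.∈ I → x ∈ xs) →
            ∀ {x} → x Subset.∈ I ∪ ⁅ v ⁆ → x ∈ v ∷ xs
      ∪-⊆ {v} I I⊆xs x∈ with x∈p∪q⁻ I ⁅ v ⁆ x∈
      ... | inj₁ x∈I = there (I⊆xs x∈I)
      ... | inj₂ x∈v = here (x∈⁅y⁆⇒x≡y v x∈v)

    -- Both sides of `bound` grow by at least the right amount: an isolated vertex costs 2 and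
    -- enlarges the set by one; a leaf with its neighbour costs 4, adds 2 to the rank and enlarges
    -- the set by one. The recursion is on `k`, since that neighbour may stand anywhere in the list.
    peel : ∀ k xs → length xs ≤ k → Unique xs → Forest G xs → Peeling xs
    peel k [] _ _ _ = record
      { columns = no-columns
      ; set     = Subset.⊥
      ; set⊆    = λ x∈ → contradiction x∈ ∉⊥
      ; indep   = λ x∈ → contradiction x∈ ∉⊥
      ; bound   = z≤n
      }
    peel (suc k) (v ∷ xs) (s≤s len) uniq@(_ ∷ uniq′) (leaf ∷ F) with any? (adj? G v) xs
    ... | no v≁ = record
      { columns = columns-weaken there P.columns
      ; set     = P.set ∪ ⁅ v ⁆
      ; set⊆    = ∪-⊆ P.set P.set⊆
      ; indep   = proj₁ I′
      ; bound   = begin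
          2 * suc (length xs)          ≡⟨ *-suc 2 (length xs) ⟩
          2 + 2 * length xs            ≤⟨ +-monoʳ-≤ 2 P.bound ⟩
          2 + (P.rank + 2 * card P.set) ≡⟨ eq P.rank (card P.set) ⟩
          P.rank + 2 * suc (card P.set) ≤⟨ +-monoʳ-≤ P.rank (*-monoʳ-≤ 2 (proj₂ I′)) ⟩
          P.rank + 2 * card (P.set ∪ ⁅ v ⁆) ∎
      }
      where
      open ≤-Reasoning
      module P = Peeling (peel k xs len uniq′ F)
      eq : ∀ r c → 2 + (r + 2 * c) ≡ r + 2 * suc c
      eq = solve-∀
      I′ = add-isolated P.set P.indep (λ x∈ v~x → v≁ (lose (P.set⊆ x∈) v~x)) (Unique[x∷xs]⇒x∉xs uniq ∘ P.set⊆)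
    ... | yes v~ = with-neighbour (find v~)
      where
      with-neighbour : ∃[ p ] p ∈ xs × Adj G v p → Peeling (v ∷ xs)
      with-neighbour (p , p∈xs , v~p) with as , bs , eq ← ∈-∃++ p∈xs = record
        { columns = columns-pair ys⊆xs p∈xs v~p v≁ys P.columns
        ; set     = P.set ∪ ⁅ v ⁆
        ; set⊆    = ∪-⊆ P.set (ys⊆xs ∘ P.set⊆)
        ; indep   = proj₁ I′
        ; bound   = begin
            2 * suc (length xs)                    ≡⟨ cong (λ l → 2 * suc l) (↭-length xs↭) ⟩
            2 * (2 + length ys)                    ≡⟨ *-distribˡ-+ 2 2 (length ys) ⟩
            4 + 2 * length ys                      ≤⟨ +-monoʳ-≤ 4 P.bound ⟩
            4 + (P.rank + 2 * card P.set)          ≡⟨ arith P.rank (card P.set) ⟩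
            2 + P.rank + 2 * suc (card P.set)      ≤⟨ +-monoʳ-≤ (2 + P.rank) (*-monoʳ-≤ 2 (proj₂ I′)) ⟩
            2 + P.rank + 2 * card (P.set ∪ ⁅ v ⁆)  ∎
        }
        where
        open ≤-Reasoning
        ys = as ++ bs
        xs↭ : xs ↭ p ∷ ys
        xs↭ = subst (_↭ p ∷ ys) (sym eq) (shift p as bs)
        ys⊆xs : ∀ {y} → y ∈ ys → y ∈ xs
        ys⊆xs = ∈-resp-↭ (↭-sym xs↭) ∘ there
        uniq-ys : Unique (p ∷ ys)
        uniq-ys = Unique-resp-↭ xs↭ uniq′
        -- The leaf condition would identify such a `y` with `p`, which no longer occurs in `ys`.
        v≁ys : ∀ {y} → y ∈ ys → ¬ Adj G v y
        v≁ys y∈ v~y = Unique[x∷xs]⇒x∉xs uniq-ys (subst (_∈ ys) (leaf (ys⊆xs y∈) p∈xs v~y v~p) y∈)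
        len-ys : length ys ≤ k
        len-ys = ≤-trans (n≤1+n _) (subst (_≤ k) (↭-length xs↭) len)
        tail-unique : ∀ {x} {xs : List (Fin n)} → Unique (x ∷ xs) → Unique xs
        tail-unique (_ ∷ u) = u
        module P = Peeling (peel k ys len-ys (tail-unique uniq-ys) (forest-remove G as (subst (Forest G) eq F)))
        arith : ∀ r c → 4 + (r + 2 * c) ≡ 2 + r + 2 * suc c
        arith = solve-∀
        I′ = add-isolated P.set P.indep (v≁ys ∘ P.set⊆) (Unique[x∷xs]⇒x∉xs uniq ∘ ys⊆xs ∘ P.set⊆)

    -- The inequality sr + 2α ≥ 2(2n - m - 1) without subtraction: `induced-forest` bounds the size
    -- of a forest from below, and `peel` bounds it from above by rank and independent set.
    rank-bound : ∀ {r α} → Connected G → IsSkewRank σ r → IsIndependenceNumber G α →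
                 4 * n ≤ r + 2 * α + 2 * numEdges G + 2
    rank-bound {r} {α} conn isRank (_ , max) with xs , g , xs↭V ← grown-ordering G conn
      with ws , _ , uniq , F , bound ← induced-forest G g (Unique-resp-↭ (↭-sym xs↭V) (allFin⁺ n)) = begin
      4 * n                                                 ≡⟨ cong (4 *_) (trans (↭-length xs↭V) (length-allFin n)) ⟨
      4 * length xs                                         ≤⟨ bound ⟩
      2 * length ws + ∑ xs (λ x → ∑ xs (adj G x)) + 2       ≤⟨ +-monoˡ-≤ 2 (+-mono-≤ forest (≤-reflexive edges)) ⟩
      r + 2 * α + 2 * numEdges G + 2                        ∎
      where
      open ≤-Reasoning
      module P = Peeling (peel (length ws) ws ≤-refl uniq F)
      forest : 2 * length ws ≤ r + 2 * α
      forest = ≤-trans P.bound (+-mono-≤ (columns≤rank isRank P.columns) (*-monoʳ-≤ 2 (max P.set P.indep)))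
      edges : ∑ xs (λ x → ∑ xs (adj G x)) ≡ 2 * numEdges G
      edges = trans (∑-↭ _ xs↭V) (trans (∑-cong (allFin n) (λ x → ∑-↭ (adj G x) xs↭V)) (handshake G))

  -- Skew matrices of rank at most two

  wedge : ∀ {n} → (e g : Fin n → ℚ) → Matrix n n
  wedge e g x y = e x ℚ.* g y ℚ.- g x ℚ.* e y

  rank-zero : ∀ {n r} (M : Matrix n n) → (∀ x y → M x y ≡ 0ℚ) → IsRank M r → r ≡ 0
  rank-zero {r = zero}  M M≡0 _              = refl
  rank-zero {r = suc r} M M≡0 ((f , ind) , _) =
    contradiction (ind (λ _ → 1ℚ) (λ x → ∑ℚ-zero (λ i → trans (ℚ.*-identityˡ (M x (f i))) (M≡0 x (f i)))) 0F) λ ()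

  -- Three independent columns `x`, `y`, `z` would satisfy explicit linear relations. These force
  -- first `W x y`, then `g x` and `e x` to vanish, after which column `x` itself is zero.
  rank-wedge : ∀ {n r} (M : Matrix n n) e g → (∀ x y → M x y ≡ wedge e g x y) → IsRank M r → r ≤ 2
  rank-wedge {r = zero}        M e g M≡ _ = z≤n
  rank-wedge {r = suc zero}    M e g M≡ _ = s≤s z≤n
  rank-wedge {r = suc (suc zero)} M e g M≡ _ = s≤s (s≤s z≤n)
  rank-wedge {n} {suc (suc (suc r))} M e g M≡ ((f , ind) , _) =
    contradiction (combination 1ℚ 0ℚ 0ℚ column-x 0F) λ ()
    where
    open +-*-Solver
    open ≡-Reasoning
    W = wedge e g
    x = f 0F
    y = f 1F
    z = f 2F
    coeff : ℚ → ℚ → ℚ → Fin (3 + r) → ℚ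
    coeff a b c 0F = a
    coeff a b c 1F = b
    coeff a b c 2F = c
    coeff a b c (Fin.suc (Fin.suc (Fin.suc _))) = 0ℚ
    combination : ∀ a b c → (∀ u → a ℚ.* W u x ℚ.+ (b ℚ.* W u y ℚ.+ c ℚ.* W u z) ≡ 0ℚ) → ∀ i → coeff a b c i ≡ 0ℚ
    combination a b c eq = ind (coeff a b c) λ u → begin
      a ℚ.* M u x ℚ.+ (b ℚ.* M u y ℚ.+ (c ℚ.* M u z ℚ.+ _))
        ≡⟨ cong (λ s → a ℚ.* M u x ℚ.+ (b ℚ.* M u y ℚ.+ s))
             (trans (cong (c ℚ.* M u z ℚ.+_) (∑ℚ-zero (λ i → ℚ.*-zeroˡ (M u (f (Fin.suc (Fin.suc (Fin.suc i))))))))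
                    (ℚ.+-identityʳ (c ℚ.* M u z))) ⟩
      a ℚ.* M u x ℚ.+ (b ℚ.* M u y ℚ.+ c ℚ.* M u z)
        ≡⟨ cong₂ ℚ._+_ (cong (a ℚ.*_) (M≡ u x)) (cong₂ ℚ._+_ (cong (b ℚ.*_) (M≡ u y)) (cong (c ℚ.*_) (M≡ u z))) ⟩
      a ℚ.* W u x ℚ.+ (b ℚ.* W u y ℚ.+ c ℚ.* W u z)
        ≡⟨ eq u ⟩
      0ℚ ∎
    -- Three vectors in the span of e and g are related by their 2 × 2 minors.
    Wxy≡0 : W x y ≡ 0ℚ
    Wxy≡0 = combination (W y z) (W z x) (W x y) (λ u →
      solve 8 (λ eu gu ex gx ey gy ez gz →
        (ey :* gz :- gy :* ez) :* (eu :* gx :- gu :* ex) :+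
        ((ez :* gx :- gz :* ex) :* (eu :* gy :- gu :* ey) :+
         (ex :* gy :- gx :* ey) :* (eu :* gz :- gu :* ez)) := con 0ℚ) refl
        (e u) (g u) (e x) (g x) (e y) (g y) (e z) (g z)) 2F
    pair : ∀ s t → (∀ u → s ℚ.* W u x ℚ.+ t ℚ.* W u y ≡ 0ℚ) → t ≡ 0ℚ
    pair s t eq = combination s t 0ℚ (λ u → trans
      (solve 3 (λ a b c → a :+ (b :+ con 0ℚ :* c) := a :+ b) refl (s ℚ.* W u x) (t ℚ.* W u y) (W u z)) (eq u)) 1F
    scaled : ∀ {a} b → a ≡ b ℚ.* W x y → a ≡ 0ℚ
    scaled b eq = trans eq (trans (cong (b ℚ.*_) Wxy≡0) (ℚ.*-zeroʳ b))
    -- Columns `x` and `y` combined with coefficients `- g y` and `g x` give `W x y` times `g`,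
    -- which is zero. The coefficients `- e y` and `e x` below give `W x y` times `e`.
    gx≡0 : g x ≡ 0ℚ
    gx≡0 = pair (ℚ.- g y) (g x) (λ u → scaled (g u)
      (solve 6 (λ eu gu ex gx ey gy →
        :- gy :* (eu :* gx :- gu :* ex) :+ gx :* (eu :* gy :- gu :* ey) := gu :* (ex :* gy :- gx :* ey)) refl
        (e u) (g u) (e x) (g x) (e y) (g y)))
    ex≡0 : e x ≡ 0ℚ
    ex≡0 = pair (ℚ.- e y) (e x) (λ u → scaled (e u)
      (solve 6 (λ eu gu ex gx ey gy →
        :- ey :* (eu :* gx :- gu :* ex) :+ ex :* (eu :* gy :- gu :* ey) := eu :* (ex :* gy :- gx :* ey)) refl
        (e u) (g u) (e x) (g x) (e y) (g y)))
    column-x : ∀ u → 1ℚ ℚ.* W u x ℚ.+ (0ℚ ℚ.* W u y ℚ.+ 0ℚ ℚ.* W u z) ≡ 0ℚ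
    column-x u = trans (cong (λ w → 1ℚ ℚ.* w ℚ.+ (0ℚ ℚ.* W u y ℚ.+ 0ℚ ℚ.* W u z))
        (trans (cong₂ (λ a b → e u ℚ.* a ℚ.- g u ℚ.* b) gx≡0 ex≡0)
               (solve 2 (λ a b → a :* con 0ℚ :- b :* con 0ℚ := con 0ℚ) refl (e u) (g u))))
      (solve 2 (λ a b → con 1ℚ :* con 0ℚ :+ (con 0ℚ :* a :+ con 0ℚ :* b) := con 0ℚ) refl (W u y) (W u z))

  wedge-antisym : ∀ {n} (e g : Fin n → ℚ) x y → wedge e g y x ≡ ℚ.- wedge e g x y
  wedge-antisym e g x y =
    solve 4 (λ ex gx ey gy → ey :* gx :- gy :* ex := :- (ex :* gy :- gx :* ey)) refl (e x) (g x) (e y) (g y)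
    where open +-*-Solver

  -- Stars and triangles

  card≡1⇒singleton : ∀ {n} {p : Subset n} → card p ≡ 1 → ∃[ x ] x Subset.∈ p × (∀ {y} → y Subset.∈ p → y ≡ x)
  card≡1⇒singleton {n} {p} ∣p∣≡1 with nonempty? p
  ... | no  empty      = contradiction (trans (sym ∣p∣≡1) (trans (cong card (Empty-unique empty)) (∣⊥∣≡0 n))) λ ()
  ... | yes (x , x∈p) = x , x∈p , unique
    where
    unique : ∀ {y} → y Subset.∈ p → y ≡ x
    unique {y} y∈p with y Fin.≟ x
    ... | yes y≡x = y≡x
    ... | no  y≢x = contradiction
      (subst₂ _<_ (∣⁅x⁆∣≡1 x) ∣p∣≡1 (p⊂q⇒∣p∣<∣q∣ ((λ z∈ → subst (Subset._∈ p) (sym (x∈⁅y⁆⇒x≡y x z∈)) x∈p) ,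
        y , y∈p , λ y∈ → y≢x (x∈⁅y⁆⇒x≡y x y∈))))
      (<-irrefl refl)

  card≡n⇒full : ∀ {n} {p : Subset n} → card p ≡ n → ∀ x → x Subset.∈ p
  card≡n⇒full {n} {p} ∣p∣≡n x with x ∈? p
  ... | yes x∈p = x∈p
  ... | no  x∉p = contradiction
    (subst₂ _<_ ∣p∣≡n (∣⊤∣≡n n) (p⊂q⇒∣p∣<∣q∣ (⊆⊤ , x , ∈⊤ , x∉p))) (<-irrefl refl)

  -- Being a star expressed inside `G`, so that ranks and edges can be treated without carrying an
  -- isomorphism.
  IsCentre : ∀ {n} → Graph n → Fin n → Set
  IsCentre G c = (∀ {x y} → Adj G x y → x ≡ c ⊎ y ≡ c) × (∀ {x} → x ≢ c → Adj G c x)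

  module _ {n} (G : Graph (suc n)) where

    centre⇒star : ∀ {c} → IsCentre G c → G ≅ star (suc n)
    centre⇒star {c} (touch , spoke) = record { bij = τ ; preserve = λ x y → mk⇔ to from }
      where
      -- Adjacency in a star depends only on which vertex is the centre, so it is enough to move `c`
      -- to the vertex 0.
      τ = transpose c 0F
      open Inverse τ using () renaming (to to ⟦_⟧)
      ⟦⟧-injective : ∀ {x y} → ⟦ x ⟧ ≡ ⟦ y ⟧ → x ≡ y
      ⟦⟧-injective {x} {y} eq =
        trans (sym (Inverse.strictlyInverseʳ τ x)) (trans (cong (Inverse.from τ) eq) (Inverse.strictlyInverseʳ τ y))
      ⟦c⟧≡0 : ⟦ c ⟧ ≡ 0F
      ⟦c⟧≡0 rewrite dec-true (c Fin.≟ c) refl = refl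
      centre : ∀ {x} → toℕ ⟦ x ⟧ ≡ 0 → x ≡ c
      centre eq = ⟦⟧-injective (trans (Fin.toℕ-injective eq) (sym ⟦c⟧≡0))
      centre⁻ : ∀ {x} → x ≡ c → toℕ ⟦ x ⟧ ≡ 0
      centre⁻ refl = cong toℕ ⟦c⟧≡0
      to : ∀ {x y} → Adj G x y → ⟦ x ⟧ ≢ ⟦ y ⟧ × (toℕ ⟦ x ⟧ ≡ 0 ⊎ toℕ ⟦ y ⟧ ≡ 0)
      to x~y = (λ eq → Graph.adj-irrefl G (⟦⟧-injective eq) x~y) , Sum.map centre⁻ centre⁻ (touch x~y)
      from : ∀ {x y} → ⟦ x ⟧ ≢ ⟦ y ⟧ × (toℕ ⟦ x ⟧ ≡ 0 ⊎ toℕ ⟦ y ⟧ ≡ 0) → Adj G x y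
      from {x} (x≢y , inj₁ eq) with refl ← centre {x} eq = spoke (λ y≡c → x≢y (cong ⟦_⟧ (sym y≡c)))
      from {x} {y} (x≢y , inj₂ eq) with refl ← centre {y} eq = Graph.adj-sym G (spoke (λ x≡c → x≢y (cong ⟦_⟧ x≡c)))

    star⇒centre : G ≅ star (suc n) → ∃[ c ] IsCentre G c
    star⇒centre G≅S = c , (λ {x} {y} x~y → Sum.map centre centre (proj₂ (Equivalence.to (preserve x y) x~y))) ,
        λ {x} x≢c → Equivalence.from (preserve c x) ((λ eq → x≢c (injective (sym eq))) , inj₁ (cong toℕ ⟦c⟧≡0))
      where
      open _≅_ G≅S
      open Inverse bij using (strictlyInverseˡ; strictlyInverseʳ) renaming (to to ⟦_⟧; from to ⟦_⟧⁻¹)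
      c : Fin (suc n)
      c = ⟦ 0F ⟧⁻¹
      ⟦c⟧≡0 : ⟦ c ⟧ ≡ 0F
      ⟦c⟧≡0 = strictlyInverseˡ 0F
      injective : ∀ {x y} → ⟦ x ⟧ ≡ ⟦ y ⟧ → x ≡ y
      injective {x} {y} eq = trans (sym (strictlyInverseʳ x)) (trans (cong ⟦_⟧⁻¹ eq) (strictlyInverseʳ y))
      centre : ∀ {x} → toℕ ⟦ x ⟧ ≡ 0 → x ≡ c
      centre eq = injective (trans (Fin.toℕ-injective eq) (sym ⟦c⟧≡0))

  complete⇒triangle : ∀ {n} (G : Graph n) → n ≡ 3 → (∀ {x y} → x ≢ y → Adj G x y) → G ≅ triangle
  complete⇒triangle G refl complete = record
    { bij      = ↔-id (Fin 3)
    ; preserve = λ x y → mk⇔ (λ x~y x≡y → Graph.adj-irrefl G x≡y x~y) complete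
    }

  module _ {n} {G : Graph n} (σ : Orientation G) where

    private
      M : Matrix n n
      M = skewAdjacency σ

    -- All nonzero entries lie in row `c` or column `c`. Hence the matrix is the wedge of the
    -- indicator of `c` with row `c`.
    rank-star : ∀ {c r} → IsCentre G c → IsSkewRank σ r → r ≤ 2
    rank-star {c} (touch , _) = rank-wedge M e (M c) M≡
      where
      open +-*-Solver
      e : Fin n → ℚ
      e x with x Fin.≟ c
      ... | yes _ = 1ℚ
      ... | no  _ = 0ℚ
      M≡ : ∀ x y → M x y ≡ wedge e (M c) x y
      M≡ x y with x Fin.≟ c | y Fin.≟ c
      ... | yes refl | yes refl = trans (skew-diagonal σ c)
        (solve 1 (λ a → con 0ℚ := con 1ℚ :* a :- a :* con 1ℚ) refl (M c c))
      ... | yes refl | no _     =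
        solve 2 (λ a b → a := con 1ℚ :* a :- b :* con 0ℚ) refl (M c y) (M c c)
      ... | no _     | yes refl = trans (skew-antisym σ c x)
        (solve 2 (λ a b → :- a := con 0ℚ :* b :- a :* con 1ℚ) refl (M c x) (M c c))
      ... | no x≢c   | no y≢c   = trans (skew-nonadjacent σ (Sum.[ x≢c , y≢c ] ∘ touch))
        (solve 2 (λ a b → con 0ℚ := con 0ℚ :* a :- b :* con 0ℚ) refl (M c y) (M c x))

  -- A skew 3 × 3 matrix with nonzero entry at (0, 1) is the wedge of column 1, divided by that
  -- entry, with row 0. By skew-symmetry only row 0 and the entry at (1, 2) need a computation.
  rank-triangle : ∀ {G : Graph 3} (σ : Orientation G) {r} → Adj G 0F 1F → IsSkewRank σ r → r ≤ 2
  rank-triangle {G} σ 0~1 = rank-wedge M e (M 0F) M≡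
    where
    open +-*-Solver
    open ≡-Reasoning
    M : Matrix 3 3
    M = skewAdjacency σ
    -- M u 1F / M 0F 1F, because M 0F 1F squares to 1.
    e : Fin 3 → ℚ
    e u = M u 1F ℚ.* M 0F 1F
    W = wedge e (M 0F)
    flip : ∀ x y → M x y ≡ W x y → M y x ≡ W y x
    flip x y eq = trans (skew-antisym σ x y) (trans (cong ℚ.-_ eq) (sym (wedge-antisym e (M 0F) x y)))
    diagonal : ∀ x → M x x ≡ W x x
    diagonal x = trans (skew-diagonal σ x)
      (solve 2 (λ a b → con 0ℚ := a :* b :- b :* a) refl (e x) (M 0F x))
    row₀ : ∀ y → M 0F y ≡ W 0F y
    row₀ y = begin
      M 0F y                                 ≡⟨ solve 2 (λ a b → a := con 1ℚ :* a :- con 0ℚ :* b) refl (M 0F y) (e y) ⟩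
      1ℚ ℚ.* M 0F y ℚ.- 0ℚ ℚ.* e y           ≡⟨ cong₂ (λ a b → a ℚ.* M 0F y ℚ.- b ℚ.* e y) (skew-square σ 0~1) (skew-diagonal σ 0F) ⟨
      W 0F y                                 ∎
    entry₁₂ : M 1F 2F ≡ W 1F 2F
    entry₁₂ = begin
      M 1F 2F             ≡⟨ solve 3 (λ a b c → a := con 0ℚ :* b :* c :- :- a :* con 1ℚ) refl (M 1F 2F) (M 0F 1F) (M 0F 2F) ⟩
      0ℚ ℚ.* M 0F 1F ℚ.* M 0F 2F ℚ.- ℚ.- M 1F 2F ℚ.* 1ℚ
        ≡⟨ cong₂ ℚ._-_ (cong (λ a → a ℚ.* M 0F 1F ℚ.* M 0F 2F) (sym (skew-diagonal σ 1F)))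
                       (cong₂ ℚ._*_ (sym (skew-antisym σ 1F 2F)) (sym (skew-square σ 0~1))) ⟩
      e 1F ℚ.* M 0F 2F ℚ.- M 2F 1F ℚ.* (M 0F 1F ℚ.* M 0F 1F)
        ≡⟨ solve 3 (λ a b c → a :- b :* (c :* c) := a :- c :* (b :* c)) refl (e 1F ℚ.* M 0F 2F) (M 2F 1F) (M 0F 1F) ⟩
      W 1F 2F ∎
    M≡ : ∀ x y → M x y ≡ W x y
    M≡ 0F y  = row₀ y
    M≡ x  0F = flip 0F x (row₀ x)
    M≡ 1F 1F = diagonal 1F
    M≡ 1F 2F = entry₁₂
    M≡ 2F 1F = flip 1F 2F entry₁₂
    M≡ 2F 2F = diagonal 2F

  -- The extremal graphs

  -- The equality case of `rank-bound`; `EdgesTight` is that of `α-bound`.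
  RankTight : (n m r α : ℕ) → Set
  RankTight n m r α = 4 * n ≡ r + 2 * α + 2 * m + 2

  EdgesTight : (n m α : ℕ) → Set
  EdgesTight n m α = 2 * m + n + α * α ≡ n * n + α

  α-bound : ∀ {n} (G : Graph n) {α} → IsIndependenceNumber G α → 2 * numEdges G + n + α * α ≤ n * n + α
  α-bound G ((I , ind , refl) , _) = edges-bound G I ind

  α≥1 : ∀ {n} (G : Graph n) {α} → Connected G → IsIndependenceNumber G α → 1 ≤ α
  α≥1 G {α} conn isα = >-nonZero⁻¹ α {{independenceNumber-nonZero G conn isα}}

  connected⇒edge : ∀ {n} (G : Graph (2 + n)) → Connected G → ∃[ x ] ∃[ y ] Adj G x y
  connected⇒edge G (_ , path) with path 0F 1F
  ... | x~y ◅ _ = _ , _ , x~y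

  tight⇒extremal : ∀ {n} {G : Graph n} (σ : Orientation G) {r α} → Connected G → IsSkewRank σ r →
    IsIndependenceNumber G α → RankTight n (numEdges G) r α → EdgesTight n (numEdges G) α →
    G ≅ star n ⊎ G ≅ triangle
  tight⇒extremal {zero} σ (() , _)
  -- One vertex is treated apart, because the general case uses an edge to obtain rank at least 2.
  tight⇒extremal {suc zero} {G} σ _ _ _ _ _ = inj₁ (centre⇒star G {0F} (touch , spoke))
    where
    touch : ∀ {x y : Fin 1} → Adj G x y → x ≡ 0F ⊎ y ≡ 0F
    touch {0F} _ = inj₁ refl
    spoke : ∀ {x : Fin 1} → x ≢ 0F → Adj G 0F x
    spoke {0F} 0≢0 = contradiction refl 0≢0
  tight⇒extremal {suc (suc n)} {G} σ {r} {α} conn isRank isα@((I , ind , refl) , _) eqA eqB =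
    by-cover (n′ ∸ α) (m+[n∸m]≡n (∣p∣≤n I))
    where
    n′ = 2 + n
    m = numEdges G
    edge = connected⇒edge G conn
    split = edges-tight G I ind eqB
    r≥2 : 2 ≤ r
    r≥2 = edge⇒rank≥2 σ (proj₂ (proj₂ edge)) isRank
    1≤α : 1 ≤ α
    1≤α = α≥1 G conn isα

    -- Here k is the size of the vertex cover complementary to I; the edge count is eliminated.
    relation : ∀ {k} → α + k ≡ n′ → 4 * α + 5 * k ≡ r + 2 * α + 2 + 2 * α * k + k * k
    relation {k} α+k≡n = +-cancelʳ-≡ (2 * m + k) _ _ (begin
      4 * α + 5 * k + (2 * m + k)                       ≡⟨ eq₁ α k m ⟩
      4 * (α + k) + (2 * m + 2 * k)                     ≡⟨ cong (_+ (2 * m + 2 * k)) A₂ ⟩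
      r + 2 * α + 2 * m + 2 + (2 * m + 2 * k)           ≡⟨ eq₂ r α m k ⟩
      r + 2 * α + 2 + (2 * m + k) + (2 * m + k)         ≡⟨ cong (λ s → r + 2 * α + 2 + s + (2 * m + k)) edges ⟩
      r + 2 * α + 2 + (2 * α * k + k * k) + (2 * m + k) ≡⟨ cong (_+ (2 * m + k)) (+-assoc (r + 2 * α + 2) (2 * α * k) (k * k)) ⟨
      r + 2 * α + 2 + 2 * α * k + k * k + (2 * m + k)   ∎)
      where
      open ≡-Reasoning
      A₂ : 4 * (α + k) ≡ r + 2 * α + 2 * m + 2
      A₂ = trans (cong (4 *_) α+k≡n) eqA
      eq₁ : ∀ α k m → 4 * α + 5 * k + (2 * m + k) ≡ 4 * (α + k) + (2 * m + 2 * k)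
      eq₁ = solve-∀
      eq₂ : ∀ r α m k → r + 2 * α + 2 * m + 2 + (2 * m + 2 * k) ≡ r + 2 * α + 2 + (2 * m + k) + (2 * m + k)
      eq₂ = solve-∀
      eq₃ : ∀ m k α → 2 * m + k + (α + α * α) ≡ 2 * m + (α + k) + α * α
      eq₃ = solve-∀
      eq₄ : ∀ k α → (α + k) * (α + k) + α ≡ 2 * α * k + k * k + (α + α * α)
      eq₄ = solve-∀
      edges : 2 * m + k ≡ 2 * α * k + k * k
      edges = +-cancelʳ-≡ (α + α * α) _ _ (begin
        2 * m + k + (α + α * α)           ≡⟨ eq₃ m k α ⟩
        2 * m + (α + k) + α * α           ≡⟨ cong (λ s → 2 * m + s + α * α) α+k≡n ⟩
        2 * m + n′ + α * α                ≡⟨ eqB ⟩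
        n′ * n′ + α                       ≡⟨ cong (λ s → s * s + α) α+k≡n ⟨
        (α + k) * (α + k) + α             ≡⟨ eq₄ k α ⟩
        2 * α * k + k * k + (α + α * α)   ∎)

    by-cover : ∀ k → α + k ≡ n′ → G ≅ star n′ ⊎ G ≅ triangle
    -- An empty cover would make the whole vertex set independent, against the existence of an edge.
    by-cover 0 α+0≡n with x , y , x~y ← edge =
      contradiction x~y (ind (full x) (full y))
      where full = card≡n⇒full {p = I} (trans (sym (+-identityʳ α)) α+0≡n)
    -- The only vertex outside `I` is the centre: edges inside `I` are excluded, and `split` joins
    -- it to all the others.
    by-cover 1 α+1≡n with c , c∈ , only ← card≡1⇒singleton {p = ∁ I}
        (trans (∣∁p∣≡n∸∣p∣ I) (trans (cong (_∸ α) (sym α+1≡n)) (m+n∸m≡n α 1))) =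
      inj₁ (centre⇒star G (touch , λ x≢c → split (x≢c ∘ sym) (x∈∁p⇒x∉p c∈ ∘ proj₁)))
      where
      ∈I : ∀ {x} → x ≢ c → x Subset.∈ I
      ∈I x≢c = x∉∁p⇒x∈p (x≢c ∘ only)
      touch : ∀ {x y} → Adj G x y → x ≡ c ⊎ y ≡ c
      touch {x} {y} x~y with x Fin.≟ c | y Fin.≟ c
      ... | yes x≡c | _       = inj₁ x≡c
      ... | no _    | yes y≡c = inj₂ y≡c
      ... | no x≢c  | no y≢c  = contradiction x~y (ind (∈I x≢c) (∈I y≢c))
    -- For k = 2 `relation` reduces to r + 2α = 4, and r ≥ 2 leaves only α = 1 and three vertices.
    by-cover 2 α+2≡n = inj₂ (complete⇒triangle G (trans (sym α+2≡n) (cong (_+ 2) α≡1)) complete)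
      where
      eq : ∀ r α → r + 2 * α + 2 + 2 * α * 2 + 4 ≡ r + 2 * α + (4 * α + 6)
      eq = solve-∀
      eq′ : ∀ α → 4 * α + 10 ≡ 4 + (4 * α + 6)
      eq′ = solve-∀
      r+2α≡4 : r + 2 * α ≡ 4
      r+2α≡4 = +-cancelʳ-≡ (4 * α + 6) _ _ (trans (sym (eq r α)) (trans (sym (relation α+2≡n)) (eq′ α)))
      α≡1 : α ≡ 1
      α≡1 = ≤-antisym (*-cancelˡ-≤ 2 (+-cancelˡ-≤ 2 (2 * α) 2
              (≤-trans (+-monoˡ-≤ (2 * α) r≥2) (≤-reflexive r+2α≡4)))) 1≤α
      complete : ∀ {x y} → x ≢ y → Adj G x y
      complete x≢y = split x≢y λ (x∈ , y∈) →
        let _ , _ , only = card≡1⇒singleton {p = I} α≡1 in x≢y (trans (only x∈) (sym (only y∈)))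
    -- With α = 1 + b, r = 2 + s and k = 3 + j, the right side of `relation` exceeds the left by
    -- `suc (excess b)`.
    by-cover (suc (suc (suc j))) α+k≡n with b , 1+b≡α ← m≤n⇒∃[o]m+o≡n 1≤α | s , refl ← m≤n⇒∃[o]m+o≡n r≥2 =
      contradiction (trans (relation α+k≡n) (trans (cong (λ α → 2 + s + 2 * α + 2 + 2 * α * (3 + j) + (3 + j) * (3 + j)) (sym 1+b≡α))
        (trans (eq s b j) (cong (λ α → 4 * α + 5 * (3 + j) + suc (excess b)) 1+b≡α)))) (m≢m+1+n (4 * α + 5 * (3 + j)))
      where
      excess : ℕ → ℕ
      excess b = 1 + s + 4 * b + 3 * j + 2 * b * j + j * j
      m≢m+1+n : ∀ m {n} → m ≢ m + suc n
      m≢m+1+n m eq = m≢1+m+n m (trans eq (+-suc m _))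
      eq : ∀ s b j → 2 + s + 2 * (1 + b) + 2 + 2 * (1 + b) * (3 + j) + (3 + j) * (3 + j)
                   ≡ 4 * (1 + b) + 5 * (3 + j) + (1 + (1 + s + 4 * b + 3 * j + 2 * b * j + j * j))
      eq = solve-∀

  -- Apart from the single vertex, of skew-rank 0, the values are r = 2 and α = m = n - 1. The
  -- leaves form the independent set that `edges-split` is applied to.
  star⇒tight : ∀ {n} {G : Graph n} (σ : Orientation G) {r α} → Connected G → IsSkewRank σ r →
    IsIndependenceNumber G α → G ≅ star n → RankTight n (numEdges G) r α × EdgesTight n (numEdges G) α
  star⇒tight {zero} σ (() , _)
  star⇒tight {suc zero} {G} σ {r} {α} conn isRank isα@((I , ind , refl) , _) _ = tightA , tightB
    where
    m = numEdges G
    α≡1 : α ≡ 1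
    α≡1 = ≤-antisym (∣p∣≤n I) (α≥1 G conn isα)
    bound : 2 * m + 1 + 1 ≤ 2
    bound = subst (λ α → 2 * m + 1 + α * α ≤ 1 + α) α≡1 (α-bound G isα)
    m≡0 : m ≡ 0
    m≡0 = n≤0⇒n≡0 (*-cancelˡ-≤ 2 (+-cancelʳ-≤ 2 (2 * m) 0 (subst (_≤ 2) (+-assoc (2 * m) 1 1) bound)))
    loop : ∀ (x y : Fin 1) → skewAdjacency σ x y ≡ 0ℚ
    loop 0F 0F = skew-diagonal σ 0F
    r≡0 : r ≡ 0
    r≡0 = rank-zero (skewAdjacency σ) loop isRank
    tightA : RankTight 1 m r α
    tightA rewrite m≡0 | r≡0 | α≡1 = refl
    tightB : EdgesTight 1 m α
    tightB rewrite m≡0 | α≡1 = refl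
  star⇒tight {suc (suc n)} {G} σ {r} {α} conn isRank isα@(_ , max) G≅S = tightA , tightB
    where
    m = numEdges G
    c = proj₁ (star⇒centre G G≅S)
    isCentre = proj₂ (star⇒centre G G≅S)
    L : Subset (2 + n)
    L = ∁ ⁅ c ⁆
    ∣L∣ : card L ≡ 1 + n
    ∣L∣ = trans (∣∁p∣≡n∸∣p∣ ⁅ c ⁆) (cong (2 + n ∸_) (∣⁅x⁆∣≡1 c))
    ∈L⇒≢c : ∀ {x} → x Subset.∈ L → x ≢ c
    ∈L⇒≢c x∈L refl = x∈∁p⇒x∉p x∈L (x∈⁅x⁆ c)
    indL : Independent G L
    indL x∈ y∈ x~y = Sum.[ ∈L⇒≢c x∈ , ∈L⇒≢c y∈ ] (proj₁ isCentre x~y)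
    split : ∀ {x y} → x ≢ y → ¬ (x Subset.∈ L × y Subset.∈ L) → Adj G x y
    split {x} {y} x≢y ¬∈ with x Fin.≟ c | y Fin.≟ c
    ... | yes refl | _        = proj₂ isCentre (x≢y ∘ sym)
    ... | no _     | yes refl = Graph.adj-sym G (proj₂ isCentre x≢y)
    ... | no x≢c   | no y≢c   = contradiction (leaf x≢c , leaf y≢c) ¬∈
      where
      leaf : ∀ {x} → x ≢ c → x Subset.∈ L
      leaf x≢c = x∉p⇒x∈∁p (x≢c ∘ x∈⁅y⁆⇒x≡y c)
    edges : EdgesTight (2 + n) m (1 + n)
    edges = subst (λ a → 2 * m + (2 + n) + a * a ≡ (2 + n) * (2 + n) + a) ∣L∣ (edges-split G L indL split)
    2m≡ : 2 * m ≡ 2 * (1 + n)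
    2m≡ = +-cancelʳ-≡ (2 + n + (1 + n) * (1 + n)) _ _
            (trans (sym (+-assoc (2 * m) (2 + n) _)) (trans edges (eq n)))
      where
      eq : ∀ n → (2 + n) * (2 + n) + (1 + n) ≡ 2 * (1 + n) + (2 + n + (1 + n) * (1 + n))
      eq = solve-∀
    α≡ : α ≡ 1 + n
    α≡ = ≤-antisym (≮⇒≥ ¬large) (subst (_≤ α) ∣L∣ (max L indL))
      where
      ¬large : ¬ (1 + n < α)
      -- With the number of edges known, `α-bound` itself fails for any independence number above
      -- the number of leaves.
      ¬large 1+n<α with j , refl ← m≤n⇒∃[o]m+o≡n 1+n<α =
        m+1+n≰m ((2 + n) * (2 + n) + α) (subst (_≤ (2 + n) * (2 + n) + α)
          (trans (cong (λ k → k + (2 + n) + α * α) 2m≡) (eq n j)) (α-bound G isα))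
        where
        eq : ∀ n j → 2 * (1 + n) + (2 + n) + (2 + n + j) * (2 + n + j)
                   ≡ (2 + n) * (2 + n) + (2 + n + j) + suc (1 + 2 * n + (3 + 2 * n) * j + j * j)
        eq = solve-∀
    r≡2 : r ≡ 2
    r≡2 = ≤-antisym (rank-star σ isCentre isRank) (edge⇒rank≥2 σ (proj₂ (proj₂ (connected⇒edge G conn))) isRank)
    tightA : RankTight (2 + n) m r α
    tightA rewrite r≡2 | α≡ | 2m≡ = eq n
      where
      eq : ∀ n → 4 * (2 + n) ≡ 2 + 2 * (1 + n) + 2 * (1 + n) + 2
      eq = solve-∀
    tightB : EdgesTight (2 + n) m α
    tightB = subst (EdgesTight (2 + n) m) (sym α≡) edges

  -- The scheme of `star⇒tight` with a singleton in place of the leaves: m = 3 comes from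
  -- `edges-split`, α = 1 from `α-bound`, r = 2 from `rank-triangle` and an edge.
  triangle⇒tight : ∀ {n} {G : Graph n} (σ : Orientation G) {r α} → Connected G → IsSkewRank σ r →
    IsIndependenceNumber G α → G ≅ triangle → RankTight n (numEdges G) r α × EdgesTight n (numEdges G) α
  triangle⇒tight {n} {G} σ {r} {α} conn isRank isα G≅T with refl ← ↔⇒≡ (_≅_.bij G≅T) = tightA , tightB
    where
    open _≅_ G≅T
    m = numEdges G
    complete : ∀ {x y} → x ≢ y → Adj G x y
    complete {x} {y} x≢y = Equivalence.from (preserve x y) λ eq →
      x≢y (trans (sym (Inverse.strictlyInverseʳ bij x)) (trans (cong (Inverse.from bij) eq) (Inverse.strictlyInverseʳ bij y)))
    single : Independent G ⁅ 0F ⁆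
    single x∈ y∈ = Graph.adj-irrefl G (trans (x∈⁅y⁆⇒x≡y 0F x∈) (sym (x∈⁅y⁆⇒x≡y 0F y∈)))
    edges : 2 * m + 3 + 1 ≡ 10
    edges = edges-split G ⁅ 0F ⁆ single (λ x≢y _ → complete x≢y)
    2m≡6 : 2 * m ≡ 6
    2m≡6 = +-cancelʳ-≡ 4 _ _ (trans (sym (+-assoc (2 * m) 3 1)) edges)
    α≤1 : α ≤ 1
    α≤1 = ≮⇒≥ ¬large
      where
      ¬large : ¬ (1 < α)
      ¬large 1<α with j , refl ← m≤n⇒∃[o]m+o≡n 1<α =
        m+1+n≰m (9 + α) (subst (_≤ 9 + α) (trans (cong (λ k → k + 3 + α * α) 2m≡6) (eq j)) (α-bound G isα))
        where
        eq : ∀ j → 9 + (2 + j) * (2 + j) ≡ 9 + (2 + j) + suc (1 + 3 * j + j * j)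
        eq = solve-∀
    α≡1 : α ≡ 1
    α≡1 = ≤-antisym α≤1 (α≥1 G conn isα)
    r≡2 : r ≡ 2
    r≡2 = ≤-antisym (rank-triangle σ (complete λ ()) isRank) (edge⇒rank≥2 σ {0F} {1F} (complete λ ()) isRank)
    tightA : RankTight 3 m r α
    tightA rewrite r≡2 | α≡1 | 2m≡6 = refl
    tightB : EdgesTight 3 m α
    tightB rewrite 2m≡6 | α≡1 = refl

open import Data.Integer as ℤ using (ℤ; +_)
import Data.Integer.Properties as ℤ
import Data.Integer.Tactic.RingSolver as ℤ-Solver
import Data.Rational.Unnormalised.Base as ℚᵘ
import Data.Rational.Unnormalised.Properties as ℚᵘ
open import Defs

-- The real bound

ι : ℤ → ℚ
ι i = i ℚ./ 1

toℚᵘ-ι : ∀ i → ℚ.toℚᵘ (ι i) ℚᵘ.≃ i ℚᵘ./ 1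
toℚᵘ-ι i = ℚ.toℚᵘ-fromℚᵘ (i ℚᵘ./ 1)

ι-+ : ∀ i j → ι (i ℤ.+ j) ≡ ι i ℚ.+ ι j
ι-+ i j = ℚ.toℚᵘ-injective (begin-equality
  ℚ.toℚᵘ (ι (i ℤ.+ j))              ≃⟨ toℚᵘ-ι (i ℤ.+ j) ⟩
  (i ℤ.+ j) ℚᵘ./ 1                  ≃⟨ ℚᵘ.*≡* (eq i j) ⟩
  i ℚᵘ./ 1 ℚᵘ.+ j ℚᵘ./ 1            ≃⟨ ℚᵘ.+-cong (toℚᵘ-ι i) (toℚᵘ-ι j) ⟨
  ℚ.toℚᵘ (ι i) ℚᵘ.+ ℚ.toℚᵘ (ι j)    ≃⟨ ℚ.toℚᵘ-homo-+ (ι i) (ι j) ⟨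
  ℚ.toℚᵘ (ι i ℚ.+ ι j)              ∎)
  where
  open ℚᵘ.≤-Reasoning
  eq : ∀ i j → (i ℤ.+ j) ℤ.* (+ 1) ≡ (i ℤ.* + 1 ℤ.+ j ℤ.* + 1) ℤ.* + 1
  eq = ℤ-Solver.solve-∀

ι-* : ∀ i j → ι (i ℤ.* j) ≡ ι i ℚ.* ι j
ι-* i j = ℚ.toℚᵘ-injective (begin-equality
  ℚ.toℚᵘ (ι (i ℤ.* j))              ≃⟨ toℚᵘ-ι (i ℤ.* j) ⟩
  (i ℤ.* j) ℚᵘ./ 1                  ≃⟨ ℚᵘ.*≡* refl ⟩
  (i ℚᵘ./ 1) ℚᵘ.* (j ℚᵘ./ 1)        ≃⟨ ℚᵘ.*-cong (toℚᵘ-ι i) (toℚᵘ-ι j) ⟨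
  ℚ.toℚᵘ (ι i) ℚᵘ.* ℚ.toℚᵘ (ι j)    ≃⟨ ℚ.toℚᵘ-homo-* (ι i) (ι j) ⟨
  ℚ.toℚᵘ (ι i ℚ.* ι j)              ∎)
  where open ℚᵘ.≤-Reasoning

/-cancel : ∀ i a → i ℚ./ suc a ℚ.* ι (+ suc a) ≡ ι i
/-cancel i a = ℚ.toℚᵘ-injective (begin-equality
  ℚ.toℚᵘ (i ℚ./ suc a ℚ.* ι (+ suc a))               ≃⟨ ℚ.toℚᵘ-homo-* (i ℚ./ suc a) (ι (+ suc a)) ⟩
  ℚ.toℚᵘ (i ℚ./ suc a) ℚᵘ.* ℚ.toℚᵘ (ι (+ suc a))     ≃⟨ ℚᵘ.*-cong (ℚ.toℚᵘ-fromℚᵘ (i ℚᵘ./ suc a)) (toℚᵘ-ι (+ suc a)) ⟩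
  (i ℚᵘ./ suc a) ℚᵘ.* ((+ suc a) ℚᵘ./ 1)             ≃⟨ ℚᵘ.*≡* (trans (ℤ.*-identityʳ _) (cong (λ k → i ℤ.* + k) (sym (ℕ.*-identityʳ (suc a))))) ⟩
  i ℚᵘ./ 1                                           ≃⟨ toℚᵘ-ι i ⟨
  ℚ.toℚᵘ (ι i)                                       ∎)
  where open ℚᵘ.≤-Reasoning

ι-mono-≤ : ∀ {i j} → i ℤ.≤ j → ι i ℚ.≤ ι j
ι-mono-≤ {i} {j} i≤j = ℚ.toℚᵘ-cancel-≤ (begin
  ℚ.toℚᵘ (ι i)  ≃⟨ toℚᵘ-ι i ⟩
  i ℚᵘ./ 1      ≤⟨ ℚᵘ.*≤* (ℤ.*-monoʳ-≤-nonNeg (+ 1) i≤j) ⟩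
  j ℚᵘ./ 1      ≃⟨ toℚᵘ-ι j ⟨
  ℚ.toℚᵘ (ι j)  ∎)
  where open ℚᵘ.≤-Reasoning

ι-cancel-≤ : ∀ {i j} → ι i ℚ.≤ ι j → i ℤ.≤ j
ι-cancel-≤ {i} {j} ιi≤ιj = subst₂ ℤ._≤_ (ℤ.*-identityʳ i) (ℤ.*-identityʳ j) (ℚᵘ.drop-*≤* (begin
  i ℚᵘ./ 1      ≃⟨ toℚᵘ-ι i ⟨
  ℚ.toℚᵘ (ι i)  ≤⟨ ℚ.toℚᵘ-mono-≤ ιi≤ιj ⟩
  ℚ.toℚᵘ (ι j)  ≃⟨ toℚᵘ-ι j ⟩
  j ℚᵘ./ 1      ∎))
  where open ℚᵘ.≤-Reasoning

-- Square root approximations and termwise comparison of reals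

square-cancel-≤ : ∀ {p q} → 0ℚ ℚ.≤ q → p ² ℚ.≤ q ² → p ℚ.≤ q
square-cancel-≤ {p} {q} 0≤q p²≤q² = ℚ.≮⇒≥ λ q<p → ℚ.<-irrefl refl (begin-strict
  p ²       ≤⟨ p²≤q² ⟩
  q ℚ.* q   ≤⟨ ℚ.*-monoˡ-≤-nonNeg q {{ℚ.nonNegative 0≤q}} (ℚ.<⇒≤ q<p) ⟩
  q ℚ.* p   <⟨ ℚ.*-monoˡ-<-pos p {{ℚ.positive (ℚ.≤-<-trans 0≤q q<p)}} q<p ⟩
  p ²       ∎)
  where open ℚ.≤-Reasoning

-- The approximations come from above: the square of each is at least `q`.
sqrtApprox-lower : ∀ {q e} k → e ² ℚ.≤ q → e ℚ.≤ sqrtApprox q k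
sqrtApprox-lower {q} k e²≤q =
  square-cancel-≤ (sqrtApprox-nonNeg q k) (ℚ.≤-trans e²≤q (sqrtApprox-upper q k))

-- An integer is a multiple of 1/(k + 1), so the least multiple whose square reaches d² is `d`
-- itself, at every index.
sqrtApprox-square : ∀ d k → sqrtApprox (ι (+ d) ²) k ≡ ι (+ d)
sqrtApprox-square d k = ℚ.≤-antisym (upper (search-lower q k (ℤ.∣ ℚ.↥ q ∣ ℕ.* suc k)))
                                    (sqrtApprox-lower k ℚ.≤-refl)
  where
  q = ι (+ d) ²
  upper : ∀ {t} → t ≡ 0 ⊎ (∃[ u ] t ≡ suc u × ((+ u) ℚ./ suc k) ² ℚ.< q) → (+ t) ℚ./ suc k ℚ.≤ ι (+ d)
  upper (inj₁ refl) = /-mono {0} {suc k} {d} {1} ℕ.z≤n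
  upper (inj₂ (u , refl , u²<q)) = /-mono {suc u} {suc k} {d} {1}
    (subst (ℕ._≤ d ℕ.* suc k) (sym (ℕ.*-identityʳ (suc u))) (ℕ.≰⇒> λ d≤u →
      ℚ.<-irrefl refl (ℚ.<-≤-trans (*-square-< {(+ u) ℚ./ suc k} {ι (+ d)} (0≤/ d 0) u²<q)
            (/-mono {d} {1} {u} {suc k} (subst (d ℕ.* suc k ℕ.≤_) (sym (ℕ.*-identityʳ u)) d≤u)))))

termwise-≤ : ∀ {x y} → (∀ k → seq x k ℚ.≤ seq y k) → x ≤ y
termwise-≤ {x} {y} h ε 0<ε = 0 , λ k _ → ℚ.≤-<-trans (h k)
  (subst (ℚ._< seq y k ℚ.+ ε) (ℚ.+-identityʳ (seq y k)) (ℚ.+-monoʳ-< (seq y k) 0<ε))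

termwise-≃ : ∀ {x y} → (∀ k → seq x k ≡ seq y k) → x ≃ y
termwise-≃ {x} {y} h ε 0<ε = 0 , λ k _ → subst (ℚ._< ε)
  (sym (trans (cong (λ q → ∣ q ℚ.- seq y k ∣) (h k)) (cong ∣_∣ (ℚ.+-inverseʳ (seq y k))))) 0<ε

-- If c < q, the gap q - c is a precision that no term of `x` can meet.
≃-upper : ∀ {q c x} → fromℚ q ≃ x → (∀ k → seq x k ℚ.≤ c) → q ℚ.≤ c
≃-upper {q} {c} {x} q≃x x≤c = ℚ.≮⇒≥ λ c<q →
  let 0<ε    = subst (ℚ._< q ℚ.- c) (ℚ.+-inverseʳ c) (ℚ.+-monoˡ-< (ℚ.- c) c<q)
      N , h = q≃x (q ℚ.- c) 0<ε
  in ℚ.<-irrefl refl (begin-strict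
    q                           <⟨ p<q+ε q (seq x N) (h N ℕ.≤-refl) ⟩
    seq x N ℚ.+ (q ℚ.- c)       ≤⟨ ℚ.+-monoˡ-≤ (q ℚ.- c) (x≤c N) ⟩
    c ℚ.+ (q ℚ.- c)             ≡⟨ solve 2 (λ c q → c :+ (q :- c) := q) refl c q ⟩
    q                           ∎)
  where
  open ℚ.≤-Reasoning
  open +-*-Solver

2ℚ : ℚ
2ℚ = ι (+ 2)

-- In the theorem ρ = sr / α and x = 2α − 1, so that (ρ + 2) (x + 1) = 2 (sr + 2α).
module RealBound (ν Δ ρ x : ℚ) (0≤ρ : 0ℚ ℚ.≤ ρ) (0≤x : 0ℚ ℚ.≤ x) where

  bound : ℝ
  bound = fromℚ ν ÷ (√ (fromℚ Δ) + fromℤ (+ 1)) [ √x+1-positive (fromℚ Δ) ] - fromℤ (+ 2)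

  private
    t : ℕ → ℚ
    t k = sqrtApprox Δ k ℚ.+ 1ℚ

    0<ρ+2 : 0ℚ ℚ.< ρ ℚ.+ 2ℚ
    0<ρ+2 = ℚ.+-mono-≤-< 0≤ρ (ℚ.positive⁻¹ 2ℚ)

    +1-pos : ∀ {e} → 0ℚ ℚ.≤ e → 0ℚ ℚ.< e ℚ.+ 1ℚ
    +1-pos 0≤e = ℚ.+-mono-≤-< 0≤e (ℚ.positive⁻¹ 1ℚ)

    0<t : ∀ k → 0ℚ ℚ.< t k
    0<t k = +1-pos (sqrtApprox-nonNeg Δ k)

    0≤recip-t : ∀ k → ℚ.NonNegative (recip (t k))
    0≤recip-t k = ℚ.nonNegative (ℚ.<⇒≤ (recip-pos (t k) (0<t k)))

    +1-mono : ∀ {e} k → e ² ℚ.≤ Δ → e ℚ.+ 1ℚ ℚ.≤ t k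
    +1-mono {e} k e²≤Δ = ℚ.+-monoˡ-≤ 1ℚ (sqrtApprox-lower {Δ} {e} k e²≤Δ)

    p+2-2≡p : ∀ p → p ℚ.+ 2ℚ ℚ.- 2ℚ ≡ p
    p+2-2≡p p = solve 2 (λ p y → (p :+ y) :- y := p) refl p 2ℚ
      where open +-*-Solver

    p-2+2≡p : ∀ p → p ℚ.- 2ℚ ℚ.+ 2ℚ ≡ p
    p-2+2≡p p = solve 2 (λ p y → (p :- y) :+ y := p) refl p 2ℚ
      where open +-*-Solver

    *-recip-cancel : ∀ p {q} → 0ℚ ℚ.< q → p ℚ.* q ℚ.* recip q ≡ p
    *-recip-cancel p {q} 0<q = trans (ℚ.*-assoc p q (recip q))
      (trans (cong (p ℚ.*_) (recip-inverse q 0<q)) (ℚ.*-identityʳ p))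

  -- The inequality holds termwise, as every `t k` is at least x + 1. Since `ν` may be negative, the
  -- factor x + 1 is enlarged to `t k` before the division.
  ratio≥bound : x ² ℚ.≤ Δ → ν ℚ.≤ (ρ ℚ.+ 2ℚ) ℚ.* (x ℚ.+ 1ℚ) → fromℚ ρ ≥ bound
  ratio≥bound x²≤Δ ν≤ = termwise-≤ {bound} {fromℚ ρ} λ k →
    subst (ν ℚ.* recip (t k) ℚ.- 2ℚ ℚ.≤_) (p+2-2≡p ρ) (ℚ.+-monoˡ-≤ (ℚ.- 2ℚ) (begin
      ν ℚ.* recip (t k)                            ≤⟨ ℚ.*-monoʳ-≤-nonNeg (recip (t k)) {{0≤recip-t k}} (ν≤[ρ+2]t k) ⟩
      (ρ ℚ.+ 2ℚ) ℚ.* t k ℚ.* recip (t k)           ≡⟨ *-recip-cancel (ρ ℚ.+ 2ℚ) (0<t k) ⟩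
      ρ ℚ.+ 2ℚ                                     ∎))
    where
    open ℚ.≤-Reasoning
    ν≤[ρ+2]t : ∀ k → ν ℚ.≤ (ρ ℚ.+ 2ℚ) ℚ.* t k
    ν≤[ρ+2]t k = ℚ.≤-trans ν≤
      (ℚ.*-monoˡ-≤-nonNeg (ρ ℚ.+ 2ℚ) {{ℚ.nonNegative (ℚ.<⇒≤ 0<ρ+2)}} (+1-mono {x} k x²≤Δ))

  module _ (ρ≃ : fromℚ ρ ≃ bound) where

    private
      upper : ∀ c → (∀ k → ν ℚ.* recip (t k) ℚ.≤ c) → ρ ℚ.+ 2ℚ ℚ.≤ c
      upper c h = subst (ρ ℚ.+ 2ℚ ℚ.≤_) (p-2+2≡p c)
        (ℚ.+-monoˡ-≤ 2ℚ (≃-upper {ρ} {c ℚ.- 2ℚ} {bound} ρ≃ (λ k → ℚ.+-monoˡ-≤ (ℚ.- 2ℚ) (h k))))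

      -- With ν ≤ 0 the fraction would stay at or below 0, while its limit ρ + 2 is positive. The
      -- sign allows the denominator to be replaced by a smaller one in `equality-lower`.
      0≤ν : 0ℚ ℚ.≤ ν
      0≤ν with ℚ.≤-total 0ℚ ν
      ... | inj₁ 0≤ν = 0≤ν
      ... | inj₂ ν≤0 = contradiction (upper 0ℚ λ k → subst (ν ℚ.* recip (t k) ℚ.≤_) (ℚ.*-zeroˡ (recip (t k)))
              (ℚ.*-monoʳ-≤-nonNeg (recip (t k)) {{0≤recip-t k}} ν≤0))
              (λ ρ+2≤0 → ℚ.<-irrefl refl (ℚ.<-≤-trans 0<ρ+2 ρ+2≤0))

    -- Every term of the fraction is at most ν/(e + 1), hence so is its limit ρ + 2. The rational
    -- `e` stands in for the root: `x` itself yields the rank equality, a slightly larger value the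
    -- gap.
    equality-lower : ∀ e → 0ℚ ℚ.≤ e → e ² ℚ.≤ Δ → (ρ ℚ.+ 2ℚ) ℚ.* (e ℚ.+ 1ℚ) ℚ.≤ ν
    equality-lower e 0≤e e²≤Δ = begin
      (ρ ℚ.+ 2ℚ) ℚ.* (e ℚ.+ 1ℚ)
        ≤⟨ ℚ.*-monoʳ-≤-nonNeg (e ℚ.+ 1ℚ) {{ℚ.nonNegative (ℚ.<⇒≤ (+1-pos 0≤e))}}
             (upper (ν ℚ.* recip (e ℚ.+ 1ℚ)) λ k →
               ℚ.*-monoˡ-≤-nonNeg ν {{ℚ.nonNegative 0≤ν}} (recip-antimono (+1-pos 0≤e) (+1-mono {e} k e²≤Δ))) ⟩
      ν ℚ.* recip (e ℚ.+ 1ℚ) ℚ.* (e ℚ.+ 1ℚ)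
        ≡⟨ solve 3 (λ a b c → a :* b :* c := a :* c :* b) refl ν (recip (e ℚ.+ 1ℚ)) (e ℚ.+ 1ℚ) ⟩
      ν ℚ.* (e ℚ.+ 1ℚ) ℚ.* recip (e ℚ.+ 1ℚ)
        ≡⟨ *-recip-cancel ν (+1-pos 0≤e) ⟩
      ν ∎
      where
      open ℚ.≤-Reasoning
      open +-*-Solver

    -- If Δ ≥ x² + 1 then √ Δ ≥ x + η for η = 1/(2x + 1), which leaves a gap.
    equality-gap : ν ℚ.≤ (ρ ℚ.+ 2ℚ) ℚ.* (x ℚ.+ 1ℚ) → ¬ (x ² ℚ.+ 1ℚ ℚ.≤ Δ)
    equality-gap ν≤ x²+1≤Δ = ℚ.<-irrefl refl (begin-strict
      s ℚ.* (x ℚ.+ 1ℚ)               ≡⟨ ℚ.+-identityʳ (s ℚ.* (x ℚ.+ 1ℚ)) ⟨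
      s ℚ.* (x ℚ.+ 1ℚ) ℚ.+ 0ℚ        <⟨ ℚ.+-monoʳ-< (s ℚ.* (x ℚ.+ 1ℚ)) (*-pos {s} {η} 0<ρ+2 0<η) ⟩
      s ℚ.* (x ℚ.+ 1ℚ) ℚ.+ s ℚ.* η   ≡⟨ solve 3 (λ s x η → s :* (x :+ con 1ℚ) :+ s :* η := s :* (x :+ η :+ con 1ℚ)) refl s x η ⟩
      s ℚ.* (x ℚ.+ η ℚ.+ 1ℚ)         ≤⟨ equality-lower (x ℚ.+ η) 0≤x+η (ℚ.≤-trans [x+η]²≤x²+1 x²+1≤Δ) ⟩
      ν                              ≤⟨ ν≤ ⟩
      s ℚ.* (x ℚ.+ 1ℚ)               ∎)
      where
      open ℚ.≤-Reasoning
      open +-*-Solver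
      s = ρ ℚ.+ 2ℚ
      w = x ℚ.+ x ℚ.+ 1ℚ
      η = recip w
      1≤w : 1ℚ ℚ.≤ w
      1≤w = ℚ.+-monoˡ-≤ 1ℚ (ℚ.+-mono-≤ 0≤x 0≤x)
      0<w : 0ℚ ℚ.< w
      0<w = ℚ.<-≤-trans (ℚ.positive⁻¹ 1ℚ) 1≤w
      0<η : 0ℚ ℚ.< η
      0<η = recip-pos w 0<w
      η≤1 : η ℚ.≤ 1ℚ
      η≤1 = recip-antimono (ℚ.positive⁻¹ 1ℚ) 1≤w
      0≤x+η : 0ℚ ℚ.≤ x ℚ.+ η
      0≤x+η = ℚ.+-mono-≤ 0≤x (ℚ.<⇒≤ 0<η)
      [x+η]²≤x²+1 : (x ℚ.+ η) ² ℚ.≤ x ² ℚ.+ 1ℚ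
      [x+η]²≤x²+1 = begin
        (x ℚ.+ η) ²                          ≡⟨ solve 2 (λ x η → (x :+ η) :* (x :+ η) := x :* x :+ (x :+ x :+ η) :* η) refl x η ⟩
        x ² ℚ.+ (x ℚ.+ x ℚ.+ η) ℚ.* η        ≤⟨ ℚ.+-monoʳ-≤ (x ²) (ℚ.*-monoʳ-≤-nonNeg η {{ℚ.nonNegative (ℚ.<⇒≤ 0<η)}} (ℚ.+-monoʳ-≤ (x ℚ.+ x) η≤1)) ⟩
        x ² ℚ.+ w ℚ.* η                      ≡⟨ cong (x ² ℚ.+_) (recip-inverse w 0<w) ⟩
        x ² ℚ.+ 1ℚ                           ∎

  tight⇒equality : ν ≡ (ρ ℚ.+ 2ℚ) ℚ.* (x ℚ.+ 1ℚ) → (∀ k → sqrtApprox Δ k ≡ x) → fromℚ ρ ≃ bound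
  tight⇒equality ν≡ √Δ≡x = termwise-≃ {fromℚ ρ} {bound} λ k → sym (begin
    ν ℚ.* recip (t k) ℚ.- 2ℚ
      ≡⟨ cong₂ (λ p q → p ℚ.* recip (q ℚ.+ 1ℚ) ℚ.- 2ℚ) ν≡ (√Δ≡x k) ⟩
    (ρ ℚ.+ 2ℚ) ℚ.* (x ℚ.+ 1ℚ) ℚ.* recip (x ℚ.+ 1ℚ) ℚ.- 2ℚ
      ≡⟨ cong (ℚ._- 2ℚ) (*-recip-cancel (ρ ℚ.+ 2ℚ) (+1-pos 0≤x)) ⟩
    ρ ℚ.+ 2ℚ ℚ.- 2ℚ
      ≡⟨ p+2-2≡p ρ ⟩
    ρ ∎)
    where open ≡-Reasoning

-- From natural numbers to the real inequality

module _ k c x y {i j} (i≡ : i ≡ + k ℤ.* + x ℤ.- c) (j≡ : j ≡ + k ℤ.* + y ℤ.- c) where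

  -- Integers containing subtractions are compared through natural numbers by writing both as k
  -- times a natural number minus a shared `c`.
  affine-mono-≤ : x ℕ.≤ y → i ℤ.≤ j
  affine-mono-≤ x≤y = subst₂ ℤ._≤_ (sym i≡) (sym j≡)
    (ℤ.+-monoˡ-≤ (ℤ.- c) (ℤ.*-monoˡ-≤-nonNeg (+ k) (ℤ.+≤+ x≤y)))

  affine-cong : x ≡ y → i ≡ j
  affine-cong x≡y = trans i≡ (trans (cong (λ z → + k ℤ.* + z ℤ.- c) x≡y) (sym j≡))

  affine-cancel-≤ : .{{_ : ℤ.Positive (+ k)}} → i ℤ.≤ j → x ℕ.≤ y
  affine-cancel-≤ i≤j = ℤ.drop‿+≤+ (ℤ.*-cancelˡ-≤-pos (+ x) (+ y) (+ k)
    (subst₂ ℤ._≤_ (eq (+ k ℤ.* + x) c) (eq (+ k ℤ.* + y) c) (ℤ.+-monoˡ-≤ c (subst₂ ℤ._≤_ i≡ j≡ i≤j))))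
    where
    eq : ∀ i c → i ℤ.- c ℤ.+ c ≡ i
    eq = ℤ-Solver.solve-∀

-- With α = `suc a` the number 2α - 1 is 1 + 2a, and adding 1 produces the factor 2α that clears the
-- denominator.
[r/α+2]*2α : ∀ r a → ((+ r) ℚ./ suc a ℚ.+ 2ℚ) ℚ.* (ι (+ (1 ℕ.+ 2 ℕ.* a)) ℚ.+ 1ℚ) ≡ ι (+ (2 ℕ.* (r ℕ.+ 2 ℕ.* suc a)))
[r/α+2]*2α r a = begin
  (ρ ℚ.+ 2ℚ) ℚ.* (ι (+ (1 ℕ.+ 2 ℕ.* a)) ℚ.+ 1ℚ)
    ≡⟨ cong ((ρ ℚ.+ 2ℚ) ℚ.*_) (trans (sym (ι-+ (+ (1 ℕ.+ 2 ℕ.* a)) (+ 1))) (trans (cong (λ k → ι (+ k)) d+1≡2α) (ι-2* (suc a)))) ⟩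
  (ρ ℚ.+ 2ℚ) ℚ.* (2ℚ ℚ.* ια)
    ≡⟨ solve 3 (λ x y z → (x :+ y) :* (y :* z) := y :* (x :* z :+ y :* z)) refl ρ 2ℚ ια ⟩
  2ℚ ℚ.* (ρ ℚ.* ια ℚ.+ 2ℚ ℚ.* ια)
    ≡⟨ cong (2ℚ ℚ.*_) (cong₂ ℚ._+_ (/-cancel (+ r) a) (sym (ι-2* (suc a)))) ⟩
  2ℚ ℚ.* (ι (+ r) ℚ.+ ι (+ (2 ℕ.* suc a)))
    ≡⟨ cong (2ℚ ℚ.*_) (ι-+ (+ r) (+ (2 ℕ.* suc a))) ⟨
  2ℚ ℚ.* ι (+ (r ℕ.+ 2 ℕ.* suc a))
    ≡⟨ ι-2* (r ℕ.+ 2 ℕ.* suc a) ⟨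
  ι (+ (2 ℕ.* (r ℕ.+ 2 ℕ.* suc a))) ∎
  where
  open ≡-Reasoning
  open +-*-Solver
  ρ = (+ r) ℚ./ suc a
  ια = ι (+ suc a)
  ι-2* : ∀ k → ι (+ (2 ℕ.* k)) ≡ 2ℚ ℚ.* ι (+ k)
  ι-2* k = trans (cong ι (ℤ.pos-* 2 k)) (ι-* (+ 2) (+ k))
  d+1≡2α : 1 ℕ.+ 2 ℕ.* a ℕ.+ 1 ≡ 2 ℕ.* suc a
  d+1≡2α = trans (ℕ.+-comm (1 ℕ.+ 2 ℕ.* a) 1) (sym (ℕ.*-suc 2 a))

module _ (n m r a : ℕ) where

  private
    α = suc a
    d = 1 ℕ.+ 2 ℕ.* a
    T = r ℕ.+ 2 ℕ.* α
    ρ = (+ r) ℚ./ suc a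
    N = (+ 4) ℤ.* ((+ 2) ℤ.* (+ n) ℤ.- (+ m) ℤ.- (+ 1))
    D = (+ 4) ℤ.* (+ n) ℤ.* ((+ n) ℤ.- (+ 1)) ℤ.- (+ 8) ℤ.* (+ m) ℤ.+ (+ 1)
    open module B = RealBound (ι N) (ι D) ρ (ι (+ d)) (0≤/ r a) (0≤/ d 0) using (bound)

    lhsN rhsN lhsD rhsD : ℕ
    lhsN = 4 ℕ.* n
    rhsN = T ℕ.+ 2 ℕ.* m ℕ.+ 2
    lhsD = 2 ℕ.* m ℕ.+ n ℕ.+ α ℕ.* α
    rhsD = n ℕ.* n ℕ.+ α

    -- Adding cN to N and 2T, or cD to D and d², gives multiples of the natural numbers above.
    cN cD : ℤ
    cN = + 4 ℤ.* + m ℤ.+ + 4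
    cD = + 8 ℤ.* + m ℤ.+ + 4 ℤ.* + n ℤ.+ + 4 ℤ.* + α ℤ.- + 1

    N≡ : N ≡ + 2 ℤ.* + lhsN ℤ.- cN
    N≡ = trans (eq (+ n) (+ m)) (cong (λ k → + 2 ℤ.* k ℤ.- cN) (sym (ℤ.pos-* 4 n)))
      where
      eq : ∀ n m → (+ 4) ℤ.* ((+ 2) ℤ.* n ℤ.- m ℤ.- (+ 1)) ≡ + 2 ℤ.* (+ 4 ℤ.* n) ℤ.- (+ 4 ℤ.* m ℤ.+ + 4)
      eq = ℤ-Solver.solve-∀

    2T≡ : + (2 ℕ.* T) ≡ + 2 ℤ.* + rhsN ℤ.- cN
    2T≡ = trans (ℤ.pos-* 2 T) (trans (eq (+ T) (+ m)) (cong (λ k → + 2 ℤ.* (+ T ℤ.+ k ℤ.+ + 2) ℤ.- cN) (sym (ℤ.pos-* 2 m))))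
      where
      eq : ∀ t m → + 2 ℤ.* t ≡ + 2 ℤ.* (t ℤ.+ + 2 ℤ.* m ℤ.+ + 2) ℤ.- (+ 4 ℤ.* m ℤ.+ + 4)
      eq = ℤ-Solver.solve-∀

    D≡ : D ≡ + 4 ℤ.* + rhsD ℤ.- cD
    D≡ = trans (eq (+ n) (+ m) (+ α)) (cong (λ k → + 4 ℤ.* (k ℤ.+ + α) ℤ.- cD) (sym (ℤ.pos-* n n)))
      where
      eq : ∀ n m α → (+ 4) ℤ.* n ℤ.* (n ℤ.- (+ 1)) ℤ.- (+ 8) ℤ.* m ℤ.+ (+ 1)
         ≡ + 4 ℤ.* (n ℤ.* n ℤ.+ α) ℤ.- (+ 8 ℤ.* m ℤ.+ + 4 ℤ.* n ℤ.+ + 4 ℤ.* α ℤ.- + 1)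
      eq = ℤ-Solver.solve-∀

    d²≡ : + d ℤ.* + d ≡ + 4 ℤ.* + lhsD ℤ.- cD
    d²≡ = begin
      + d ℤ.* + d
        ≡⟨ cong (λ k → (+ 1 ℤ.+ k) ℤ.* (+ 1 ℤ.+ k)) (ℤ.pos-* 2 a) ⟩
      (+ 1 ℤ.+ + 2 ℤ.* + a) ℤ.* (+ 1 ℤ.+ + 2 ℤ.* + a)
        ≡⟨ eq (+ n) (+ m) (+ a) ⟩
      + 4 ℤ.* (+ 2 ℤ.* + m ℤ.+ + n ℤ.+ + α ℤ.* + α) ℤ.- cD
        ≡⟨ cong₂ (λ k l → + 4 ℤ.* (k ℤ.+ + n ℤ.+ l) ℤ.- cD) (ℤ.pos-* 2 m) (ℤ.pos-* α α) ⟨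
      + 4 ℤ.* + lhsD ℤ.- cD ∎
      where
      open ≡-Reasoning
      eq : ∀ n m a → (+ 1 ℤ.+ + 2 ℤ.* a) ℤ.* (+ 1 ℤ.+ + 2 ℤ.* a)
         ≡ + 4 ℤ.* (+ 2 ℤ.* m ℤ.+ n ℤ.+ (+ 1 ℤ.+ a) ℤ.* (+ 1 ℤ.+ a))
             ℤ.- (+ 8 ℤ.* m ℤ.+ + 4 ℤ.* n ℤ.+ + 4 ℤ.* (+ 1 ℤ.+ a) ℤ.- + 1)
      eq = ℤ-Solver.solve-∀

  module _ (rank≤ : 4 ℕ.* n ℕ.≤ r ℕ.+ 2 ℕ.* α ℕ.+ 2 ℕ.* m ℕ.+ 2)
           (edges≤ : 2 ℕ.* m ℕ.+ n ℕ.+ α ℕ.* α ℕ.≤ n ℕ.* n ℕ.+ α) where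

    private
      ν≤ : ι N ℚ.≤ (ρ ℚ.+ 2ℚ) ℚ.* (ι (+ d) ℚ.+ 1ℚ)
      ν≤ = subst (ι N ℚ.≤_) (sym ([r/α+2]*2α r a))
        (ι-mono-≤ (affine-mono-≤ 2 cN lhsN rhsN N≡ 2T≡ rank≤))

      d²≤D : ι (+ d) ² ℚ.≤ ι D
      d²≤D = subst (ℚ._≤ ι D) (ι-* (+ d) (+ d))
        (ι-mono-≤ (affine-mono-≤ 4 cD lhsD rhsD d²≡ D≡ edges≤))

    real-bound : fromℚ ρ ≥ bound
    real-bound = B.ratio≥bound d²≤D ν≤

    real-equality : (fromℚ ρ ≃ bound) ⇔ (RankTight n m r α × EdgesTight n m α)
    real-equality = mk⇔
      (λ ρ≃ → rank≡ ρ≃ , edges≡ ρ≃)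
      (λ (rank≡ , edges≡) → B.tight⇒equality (ν≡ rank≡) (√D≡d edges≡))
      where
      2T≤N : fromℚ ρ ≃ bound → + (2 ℕ.* T) ℤ.≤ N
      2T≤N ρ≃ = ι-cancel-≤ (subst (ℚ._≤ ι N) ([r/α+2]*2α r a) (B.equality-lower ρ≃ (ι (+ d)) (0≤/ d 0) d²≤D))
      D≤d² : fromℚ ρ ≃ bound → D ℤ.≤ + d ℤ.* + d
      -- Integrality enters here: `D` above d² is at least d² + 1, which is the situation excluded
      -- by `equality-gap`.
      D≤d² ρ≃ = ℤ.≮⇒≥ λ d²<D → B.equality-gap ρ≃ ν≤
        (subst (ℚ._≤ ι D) (trans (ι-+ (+ d ℤ.* + d) (+ 1)) (cong (ℚ._+ 1ℚ) (ι-* (+ d) (+ d))))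
          (ι-mono-≤ (subst (ℤ._≤ D) (ℤ.+-comm (+ 1) (+ d ℤ.* + d)) (ℤ.i<j⇒suc[i]≤j d²<D))))
      ν≡ : RankTight n m r α → ι N ≡ (ρ ℚ.+ 2ℚ) ℚ.* (ι (+ d) ℚ.+ 1ℚ)
      ν≡ rank≡ = trans (cong ι (affine-cong 2 cN lhsN rhsN N≡ 2T≡ rank≡))
                       (sym ([r/α+2]*2α r a))
      Δ≡ : EdgesTight n m α → ι D ≡ ι (+ d) ²
      Δ≡ edges≡ = trans (cong ι (sym (affine-cong 4 cD lhsD rhsD d²≡ D≡ edges≡)))
                        (ι-* (+ d) (+ d))
      √D≡d : EdgesTight n m α → ∀ k → sqrtApprox (ι D) k ≡ ι (+ d)
      √D≡d edges≡ k = trans (cong (λ q → sqrtApprox q k) (Δ≡ edges≡)) (sqrtApprox-square d k)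
      rank≡ : fromℚ ρ ≃ bound → RankTight n m r α
      rank≡ ρ≃ = ℕ.≤-antisym rank≤ (affine-cancel-≤ 2 cN rhsN lhsN 2T≡ N≡ (2T≤N ρ≃))
      edges≥ : fromℚ ρ ≃ bound → rhsD ℕ.≤ lhsD
      edges≥ ρ≃ = affine-cancel-≤ 4 cD rhsD lhsD D≡ d²≡ (D≤d² ρ≃)
      edges≡ : fromℚ ρ ≃ bound → EdgesTight n m α
      edges≡ ρ≃ = ℕ.≤-antisym edges≤ (edges≥ ρ≃)

theorem1p6 : ∀ {n : ℕ} (G : Graph n) (σ : Orientation G) (conn : Connected G)
    (sr α : ℕ) (isRank : IsSkewRank σ sr) (isα : IsIndependenceNumber G α) →
    let m = numEdges G
        N = (+ 4) ℤ.* ((+ 2) ℤ.* (+ n) ℤ.- (+ m) ℤ.- (+ 1))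
        D = (+ 4) ℤ.* (+ n) ℤ.* ((+ n) ℤ.- (+ 1)) ℤ.- (+ 8) ℤ.* (+ m) ℤ.+ (+ 1)
        ratio = fromℚ (ℚ._/_ (+ sr) α {{independenceNumber-nonZero G conn isα}})
        bound = fromℤ N ÷ (√ (fromℤ D) + fromℤ (+ 1)) [ √x+1-positive (fromℤ D) ] - fromℤ (+ 2)
    in (ratio ≥ bound) × ((ratio ≃ bound) ⇔ ((G ≅ star n) ⊎ (G ≅ triangle)))
theorem1p6 G σ conn sr zero isRank isα = contradiction (α≥1 G conn isα) λ ()
-- Once `α` is a successor, the ratio of the statement is the `ρ` of `real-bound` and
-- `real-equality`.
theorem1p6 {n} G σ conn sr (suc a) isRank isα =
  real-bound n m sr a rank≤ edges≤ ,
  mk⇔ (λ eq → let rank≡ , edges≡ = Equivalence.to equality eq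
              in tight⇒extremal σ conn isRank isα rank≡ edges≡)
      (Equivalence.from equality ∘ Sum.[ star⇒tight σ conn isRank isα , triangle⇒tight σ conn isRank isα ])
  where
  m = numEdges G
  rank≤ = rank-bound σ conn isRank isα
  edges≤ = α-bound G isα
  equality = real-equality n m sr a rank≤ edges≤
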